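{- For all sufficiently large $k$, $$\frac{k^5}{2^{13}\cdot 10^{39}}\leq AW(k;3),$$ and $AW(k;3)\leq \frac{k^5}{120}(1+o(1))$ as $k\to\infty$.
   Context: A sequence of positive integers $w_1<\dots<w_n$ is an ascending wave if $w_{i+1}-w_i \geq w_i-w_{i-1}$ for $2\le i\le n-1$. For positive integers $k,r$, $AW(k;r)$ denotes the least positive integer $N$ such that every $r$-coloring of $\{1,\dots,N\}$ contains a $k$-term monochromatic ascending wave. -}

module Defs where

open import Data.Nat using (ℕ; zero; suc; _+_; _^_; _∸_; _≤_; _<_; _≥_; z≤n; s≤s; _≟_; _≤?_; _<?_)
open import Data.Nat.Properties
open import Data.Fin as Fin using (Fin; toℕ; fromℕ<; finToFun; funToFin)
import Data.Fin.Properties as Finₚ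
open import Data.Integer using (+_)
open import Data.Rational.Unnormalised as ℚᵘ using (ℚᵘ; 0ℚᵘ; ∣_∣)
open import Data.Product using (∃; ∃-syntax; _×_; _,_; proj₁; proj₂)
open import Data.Sum as Sum using (_⊎_; inj₁; inj₂)
open import Data.Empty using (⊥-elim)
open import Function using (_∘_)
open import Relation.Nullary using (Dec; yes; no)
open import Relation.Nullary.Decidable using (map′; _×-dec_; _→-dec_)
open import Relation.Unary using (Decidable)
open import Relation.Binary.PropositionalEquality using (_≡_; refl; sym; trans; cong; subst; _≗_; subst₂)

-- Truncated subtraction is exact here, because the terms increase.
record IsAscendingWave {n : ℕ} (w : Fin n → ℕ) : Set where
  constructor ascendingWave
  field
    positive   : ∀ i → 1 ≤ w i
    increasing : ∀ i j → i Fin.< j → w i < w j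
    convex     : ∀ h i j → toℕ i ≡ suc (toℕ h) → toℕ j ≡ suc (toℕ i) →
                 w j ∸ w i ≥ w i ∸ w h

-- Fin N stands for {1, …, N}: i is the integer value i.
value : ∀ {N} → Fin N → ℕ
value i = suc (toℕ i)

Coloring : ℕ → ℕ → Set
Coloring N r = Fin N → Fin r

IsMonochromaticWave : ∀ {N r k} → Coloring N r → (Fin k → Fin N) → Set
IsMonochromaticWave χ w =
  IsAscendingWave (value ∘ w) × (∀ i j → χ (w i) ≡ χ (w j))

ContainsMonochromaticWave : ∀ {N r} → ℕ → Coloring N r → Set
ContainsMonochromaticWave {N} k χ = ∃[ w ] IsMonochromaticWave {N} {_} {k} χ w

Forces : ℕ → ℕ → ℕ → Set
Forces k r N = (χ : Coloring N r) → ContainsMonochromaticWave k χ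

record IsAW (k r N : ℕ) : Set where
  constructor isAW
  field
    positive : 1 ≤ N
    forces   : Forces k r N
    least    : ∀ M → 1 ≤ M → Forces k r M → N ≤ M

-- The remaining lemmas up to AW show that the least N exists: Forces is
-- decidable, and some positive N is forcing.

IsAscendingWave? : ∀ {n} (w : Fin n → ℕ) → Dec (IsAscendingWave w)
IsAscendingWave? w =
  map′ (λ (p , q , c) → ascendingWave p q c)
       (λ (ascendingWave p q c) → p , q , c)
       (Finₚ.all? (λ i → 1 ≤? w i)
        ×-dec Finₚ.all? (λ i → Finₚ.all? λ j → (i Finₚ.<? j) →-dec (w i <? w j))
        ×-dec Finₚ.all? (λ h → Finₚ.all? λ i → Finₚ.all? λ j →
                (toℕ i ≟ suc (toℕ h)) →-dec (toℕ j ≟ suc (toℕ i))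
                →-dec (w i ∸ w h ≤? w j ∸ w i)))

IsAscendingWave-resp : ∀ {n} {v w : Fin n → ℕ} → v ≗ w →
                       IsAscendingWave v → IsAscendingWave w
IsAscendingWave-resp eq (ascendingWave p q c) = ascendingWave
  (λ i → subst (1 ≤_) (eq i) (p i))
  (λ i j i<j → subst₂ _<_ (eq i) (eq j) (q i j i<j))
  (λ h i j e f → subst₂ _≤_ (cong₂∸ (eq i) (eq h)) (cong₂∸ (eq j) (eq i)) (c h i j e f))
  where
  cong₂∸ : ∀ {a b c d} → a ≡ b → c ≡ d → a ∸ c ≡ b ∸ d
  cong₂∸ refl refl = refl

anyFunction? : ∀ {m n} {P : (Fin m → Fin n) → Set} →
               (∀ {f g} → f ≗ g → P f → P g) → Decidable P → Dec (∃ P)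
anyFunction? {m} {n} resp P? =
  map′ (λ (i , p) → finToFun i , p)
       (λ (f , p) → funToFin f , resp (λ i → sym (Finₚ.finToFun-funToFin f i)) p)
       (Finₚ.any? {n = n ^ m} (P? ∘ finToFun))

allFunctions? : ∀ {m n} {P : (Fin m → Fin n) → Set} →
                (∀ {f g} → f ≗ g → P f → P g) → Decidable P → Dec (∀ f → P f)
allFunctions? {m} {n} resp P? =
  map′ (λ p f → resp (Finₚ.finToFun-funToFin f) (p (funToFin f)))
       (λ p i → p (finToFun i))
       (Finₚ.all? {n = n ^ m} (P? ∘ finToFun))

Forces? : ∀ k r N → Dec (Forces k r N)
Forces? k r N = allFunctions?
  (λ eq (w , wave , mono) → w , wave , λ i j →
     trans (sym (eq (w i))) (trans (mono i j) (eq (w j))))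
  (λ χ → anyFunction?
    (λ eq (wave , mono) → IsAscendingWave-resp (λ i → cong value (eq i)) wave ,
       λ i j → trans (cong χ (sym (eq i))) (trans (mono i j) (cong χ (eq j))))
    (λ w → IsAscendingWave? (value ∘ w)
           ×-dec Finₚ.all? (λ i → Finₚ.all? λ j → χ (w i) Finₚ.≟ χ (w j))))

leastWitness : ∀ {P : ℕ → Set} → Decidable P → ∀ n → P n →
               ∃[ m ] P m × (∀ j → P j → m ≤ j)
leastWitness P? zero p = zero , p , λ _ _ → z≤n
leastWitness {P} P? (suc n) p with P? zero
... | yes p₀ = zero , p₀ , λ _ _ → z≤n
... | no ¬p₀ with leastWitness (P? ∘ suc) n p
... | m , pm , least = suc m , pm , least′
  where
  least′ : ∀ j → P j → suc m ≤ j
  least′ zero    q = ⊥-elim (¬p₀ q)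
  least′ (suc j) q = s≤s (least j q)

-- n terms satisfying P that, placed after x with all gaps at least d,
-- have nondecreasing gaps.
data Chain (P : ℕ → Set) : (n x d : ℕ) → Set where
  nil  : ∀ {x d} → Chain P 0 x d
  cons : ∀ {n x d} y → x < y → d ≤ y ∸ x → P y → Chain P n y (y ∸ x) →
         Chain P (suc n) x d

module _ {P : ℕ → Set} where

  term : ∀ {n x d} → Chain P n x d → Fin n → ℕ
  term (cons y _ _ _ _) Fin.zero    = y
  term (cons y _ _ _ t) (Fin.suc i) = term t i

  term-P : ∀ {n x d} (t : Chain P n x d) i → P (term t i)
  term-P (cons _ _ _ p _) Fin.zero    = p
  term-P (cons _ _ _ _ t) (Fin.suc i) = term-P t i

  term-> : ∀ {n x d} (t : Chain P n x d) i → x < term t i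
  term-> (cons _ x<y _ _ _) Fin.zero    = x<y
  term-> (cons _ x<y _ _ t) (Fin.suc i) = <-trans x<y (term-> t i)

  term-increasing : ∀ {n x d} (t : Chain P n x d) i j → i Fin.< j → term t i < term t j
  term-increasing (cons _ _ _ _ t) Fin.zero    (Fin.suc j) _         = term-> t j
  term-increasing (cons _ _ _ _ t) (Fin.suc i) (Fin.suc j) (s≤s i<j) = term-increasing t i j i<j

  term-convex : ∀ {n x d} (t : Chain P n x d) h i j →
                toℕ i ≡ suc (toℕ h) → toℕ j ≡ suc (toℕ i) →
                term t j ∸ term t i ≥ term t i ∸ term t h
  term-convex (cons _ _ _ _ (cons _ _ _ _ (cons _ _ g _ _)))
              Fin.zero (Fin.suc Fin.zero) (Fin.suc (Fin.suc Fin.zero)) _ _ = g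
  term-convex (cons _ _ _ _ (cons _ _ _ _ (cons _ _ _ _ _)))
              Fin.zero (Fin.suc Fin.zero) (Fin.suc (Fin.suc (Fin.suc _))) _ ()
  term-convex (cons _ _ _ _ (cons _ _ _ _ nil)) Fin.zero (Fin.suc Fin.zero) (Fin.suc Fin.zero) _ ()
  term-convex (cons _ _ _ _ t) (Fin.suc h) (Fin.suc i) (Fin.suc j) e f =
    term-convex t h i j (suc-injective e) (suc-injective f)

mapChain : ∀ {P Q : ℕ → Set} → (∀ {y} → P y → Q y) →
           ∀ {n x d} → Chain P n x d → Chain Q n x d
mapChain g nil                 = nil
mapChain g (cons y x<y gap p t) = cons y x<y gap (g p) (mapChain g t)

ColoredIn : (ℕ → ℕ) → (lo hi col : ℕ) → ℕ → Set
ColoredIn c lo hi col y = lo < y × y ≤ hi × c y ≡ col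

Found : (ℕ → ℕ) → (lo hi k : ℕ) → Set
Found c lo hi k = ∃[ col ] ∃[ x ] ∃[ d ] Chain (ColoredIn c lo hi col) k x d

UsesColorsBelow : ℕ → (ℕ → ℕ) → (lo hi : ℕ) → Set
UsesColorsBelow r c lo hi = ∀ y → lo < y → y ≤ hi → c y < r

widen : ∀ {c lo lo′ hi hi′ k} → lo′ ≤ lo → hi ≤ hi′ → Found c lo hi k → Found c lo′ hi′ k
widen a b (col , x , d , t) = col , x , d ,
  mapChain (λ (p , q , e) → ≤-<-trans a p , ≤-trans q b , e) t

span : (L n d : ℕ) → ℕ
span L zero    d = 0
span L (suc n) d = (d + L) + span L n (d + L)

span-mono : ∀ L n {d e} → d ≤ e → span L n d ≤ span L n e
span-mono L zero    d≤e = z≤n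
span-mono L (suc n) d≤e = +-mono-≤ (+-monoˡ-≤ L d≤e) (span-mono L n (+-monoˡ-≤ L d≤e))

-- Greedy step: either color r recurs within distance L, which extends the
-- chain, or some window of length L uses only colors below r.
extend : ∀ {L r k} → (∀ c a → UsesColorsBelow r c a (a + L) → Found c a (a + L) k) →
         ∀ c lo hi → UsesColorsBelow (suc r) c lo hi →
         ∀ n x d → lo ≤ x → x + span L n d ≤ hi →
         Found c lo hi k ⊎ Chain (ColoredIn c lo hi r) n x d
extend rec c lo hi below zero x d lo≤x fits = inj₂ nil
extend {L} {r} rec c lo hi below (suc n) x d lo≤x fits
  with anyUpTo? (λ i → c (x + (d + suc i)) ≟ r) L
... | no none = inj₁ (widen lo≤a a+L≤hi (rec c a below′))
  where
  a = x + d
  lo≤a : lo ≤ a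
  lo≤a = ≤-trans lo≤x (m≤m+n x d)
  a+L≤hi : a + L ≤ hi
  a+L≤hi = ≤-trans (≤-reflexive (+-assoc x d L)) (≤-trans (+-monoʳ-≤ x (m≤m+n (d + L) _)) fits)
  below′ : UsesColorsBelow r c a (a + L)
  below′ y a<y y≤a+L = ≤∧≢⇒< (≤-pred (below y (≤-<-trans lo≤a a<y) (≤-trans y≤a+L a+L≤hi)))
    λ cy≡r → none (y ∸ suc a , +-cancelˡ-≤ a _ _ (≤-trans (≤-reflexive y≡) y≤a+L) ,
                   trans (cong c (trans (sym (+-assoc x d _)) y≡)) cy≡r)
    where
    y≡ : a + suc (y ∸ suc a) ≡ y
    y≡ = trans (+-suc a _) (m+[n∸m]≡n a<y)
... | yes (i , i<L , cy≡r) =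
  Sum.map₂ (cons y x<y (≤-trans (m≤m+n d (suc i)) (≤-reflexive (sym y∸x≡)))
                 (≤-<-trans lo≤x x<y , y≤hi , cy≡r))
           (extend rec c lo hi below n y (y ∸ x) (≤-trans lo≤x (<⇒≤ x<y)) fits′)
  where
  y = x + (d + suc i)
  x<y : x < y
  x<y = m<m+n x (≤-trans (s≤s z≤n) (m≤n+m (suc i) d))
  y∸x≡ : y ∸ x ≡ d + suc i
  y∸x≡ = m+n∸m≡n x (d + suc i)
  gap≤ : d + suc i ≤ d + L
  gap≤ = +-monoʳ-≤ d i<L
  y≤hi : y ≤ hi
  y≤hi = ≤-trans (+-monoʳ-≤ x (≤-trans gap≤ (m≤m+n (d + L) _))) fits
  fits′ : y + span L n (y ∸ x) ≤ hi
  fits′ = ≤-trans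
    (≤-trans (≤-reflexive (+-assoc x (d + suc i) _))
             (+-monoʳ-≤ x (+-mono-≤ gap≤ (span-mono L n (≤-trans (≤-reflexive y∸x≡) gap≤)))))
    fits

forcingLength : ∀ k r → ∃[ L ] (∀ c a → UsesColorsBelow r c a (a + L) → Found c a (a + L) k)
forcingLength k zero = 1 , λ c a below → ⊥-elim (n≮0 (below (a + 1) (m<m+n a (s≤s z≤n)) ≤-refl))
forcingLength k (suc r) with forcingLength k r
... | L , rec = span L k 0 , λ c a below → merge c a (extend rec c a _ below k a 0 ≤-refl ≤-refl)
  where
  merge : ∀ c a → Found c a (a + span L k 0) k ⊎ Chain (ColoredIn c a (a + span L k 0) r) k a 0 →
          Found c a (a + span L k 0) k
  merge c a (inj₁ found) = found
  merge c a (inj₂ t)     = r , a , 0 , t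

module _ {N r : ℕ} (χ : Coloring N r) where

  extended : ℕ → ℕ
  extended zero = 0
  extended (suc y) with y <? N
  ... | yes y<N = toℕ (χ (fromℕ< y<N))
  ... | no _    = 0

  extended-value : ∀ i → extended (value i) ≡ toℕ (χ i)
  extended-value i with toℕ i <? N
  ... | yes p = cong (toℕ ∘ χ) (Finₚ.fromℕ<-toℕ i p)
  ... | no ¬p = ⊥-elim (¬p (Finₚ.toℕ<n i))

  position : ∀ y → 0 < y → y ≤ N → ∃[ i ] value {N} i ≡ y
  position (suc y) _ y<N = fromℕ< y<N , cong suc (Finₚ.toℕ-fromℕ< y<N)

  extended-below : UsesColorsBelow r extended 0 N
  extended-below y 0<y y≤N with position y 0<y y≤N
  ... | i , refl = subst (_< r) (sym (extended-value i)) (Finₚ.toℕ<n (χ i))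

  fromFound : ∀ {k} → Found extended 0 N k → ContainsMonochromaticWave k χ
  fromFound {k} (col , x , d , t) =
    w , IsAscendingWave-resp (λ i → sym (w-value i)) wave ,
    λ i j → Finₚ.toℕ-injective (trans (w-color i) (sym (w-color j)))
    where
    at : ∀ i → ∃[ p ] value {N} p ≡ term t i
    at i = let (lo , hi , _) = term-P t i in position (term t i) lo hi
    w : Fin k → Fin N
    w i = proj₁ (at i)
    w-value : ∀ i → value (w i) ≡ term t i
    w-value i = proj₂ (at i)
    w-color : ∀ i → toℕ (χ (w i)) ≡ col
    w-color i = trans (sym (extended-value (w i)))
                      (trans (cong extended (w-value i)) (proj₂ (proj₂ (term-P t i))))
    wave : IsAscendingWave (term t)
    wave = ascendingWave (λ i → proj₁ (term-P t i)) (term-increasing t) (term-convex t)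

forcing : ∀ k r → ∃[ N ] 1 ≤ N × Forces k r N
forcing k r with forcingLength k r
... | L , found = suc L , s≤s z≤n , λ χ → fromFound χ
  (widen z≤n (n≤1+n L) (found (extended χ) 0 λ y 0<y y≤L →
    extended-below χ y 0<y (m≤n⇒m≤1+n y≤L)))

leastForcing : ∀ k r → ∃[ N ] IsAW k r N
leastForcing k r with forcing k r
... | N , N-forcing with leastWitness (λ M → (1 ≤? M) ×-dec Forces? k r M) N N-forcing
... | M , (pos , forces) , least = M , isAW pos forces λ j 1≤j f → least j (1≤j , f)

AW : ℕ → ℕ → ℕ
AW k r = proj₁ (leastForcing k r)

AW-isAW : ∀ k r → IsAW k r (AW k r)
AW-isAW k r = proj₂ (leastForcing k r)

Eventually : (ℕ → Set) → Set
Eventually P = ∃[ K ] (∀ k → K ≤ k → P k)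

IsLittleO[1] : (ℕ → ℚᵘ) → Set
IsLittleO[1] f = ∀ ε → 0ℚᵘ ℚᵘ.< ε → Eventually λ k → ∣ f k ∣ ℚᵘ.≤ ε

fromℕ : ℕ → ℚᵘ
fromℕ n = + n ℚᵘ./ 1

{-# OPTIONS --safe #-}
module Submission where

-- Upper bound.  Suppose windows of length f(k) force a k-term wave for one color fewer.
-- A monochromatic k-term wave whose last gap is at most δ(k) either extends, with last gap at
-- most δ(k) + f(k+1), or is followed by a window of length f(k+1) that avoids its color.  So
-- δ(k+1) = δ(k) + f(k+1), and a length F with F(k+1) = F(k) + δ(k+1) suffices.  Starting from
-- F(k) = k for one color, 120 F(k) = k(k+1)(k+2)(k+3)(k+4) for three.
--
-- Lower bound.  Given a coloring φ of a cell of length L with R − 1 colors and no m-term wave,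
-- color each cell by a copy of φ that misses one of R colors.  Cells are grouped into
-- superblocks of P = 2R cells; cell j of superblock s misses color ⌊(j + t(s)) / 2⌋ mod R for a
-- random t(s) < P.  Every superblock misses every color in some cell, so after 2Pm terms a wave
-- has gap at least L.  From then on, cut the wave into runs of T steps and record at the start
-- of each run the position in units of q = Th and the gap in units of h, where L = 2q.  If the
-- recorded gap grows by g during a run, the next recorded position has g + 2 possible values;
-- and if g = 0, all positions of the run are known up to L, so that the run is monochromatic
-- with probability at most 1/16.  Weighting growth by powers of 16, the expected number of
-- surviving records of J runs with growth up to G is at most 16^G / 2^J.  Hence some t forces
-- the gap up to G h with G proportional to J, which multiplies the length by order k².

open import Defs
open import Data.Nat using (ℕ; _*_; _^_)
open import Data.Integer using (+_)
open import Data.Rational.Unnormalised as ℚᵘ using (ℚᵘ; 1ℚᵘ; _/_)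
open import Data.Product using (∃-syntax; _×_)

open import Data.Bool using (Bool; true; false; if_then_else_; _∧_) renaming (T to True)
open import Data.Empty using (⊥; ⊥-elim)
open import Data.Fin as Fin using (Fin; toℕ; fromℕ<; punchIn; punchOut)
open import Data.Fin.Properties using (toℕ-injective; toℕ-fromℕ<; toℕ<n; punchInᵢ≢i; punchIn-injective; punchIn-punchOut)
import Data.Fin.Properties as Finₚ
import Data.Integer as ℤ
import Data.Integer.Properties as ℤ
open import Data.Nat hiding (_/_)
open import Data.Nat.DivMod renaming (_/_ to infixl 7 _÷_)
open import Data.Nat.Divisibility using (divides)
open import Data.Nat.Properties
open import Data.Nat.Tactic.RingSolver using (solve-∀)
open import Data.Product using (_,_; proj₁; proj₂)
open import Data.Sum using (inj₁; inj₂)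
open import Function using (_∘_)
open import Relation.Nullary using (yes; no)
open import Relation.Binary.PropositionalEquality

-- Finite sums

sum< : ℕ → (ℕ → ℕ) → ℕ
sum< zero    f = 0
sum< (suc n) f = f n + sum< n f

sum<-mono : ∀ n {f g : ℕ → ℕ} → (∀ i → i < n → f i ≤ g i) → sum< n f ≤ sum< n g
sum<-mono zero    le = z≤n
sum<-mono (suc n) le = +-mono-≤ (le n ≤-refl) (sum<-mono n λ i i<n → le i (m<n⇒m<1+n i<n))

sum<-cong : ∀ n {f g : ℕ → ℕ} → (∀ i → f i ≡ g i) → sum< n f ≡ sum< n g
sum<-cong zero    eq = refl
sum<-cong (suc n) eq = cong₂ _+_ (eq n) (sum<-cong n eq)

sum<-+ : ∀ n (f g : ℕ → ℕ) → sum< n (λ i → f i + g i) ≡ sum< n f + sum< n g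
sum<-+ zero    f g = refl
sum<-+ (suc n) f g rewrite sum<-+ n f g = interchange (f n) (g n) (sum< n f) (sum< n g)
  where
  interchange : ∀ a b c d → a + b + (c + d) ≡ a + c + (b + d)
  interchange = solve-∀

sum<-* : ∀ n c (f : ℕ → ℕ) → c * sum< n f ≡ sum< n (λ i → c * f i)
sum<-* zero    c f = *-zeroʳ c
sum<-* (suc n) c f = trans (*-distribˡ-+ c (f n) _) (cong (λ z → c * f n + z) (sum<-* n c f))

sum<-const : ∀ n c → sum< n (λ _ → c) ≡ n * c
sum<-const zero    c = refl
sum<-const (suc n) c = cong (λ z → c + z) (sum<-const n c)

term≤sum< : ∀ n (f : ℕ → ℕ) {i} → i < n → f i ≤ sum< n f
term≤sum< (suc n) f {i} (s≤s i≤n) with m≤n⇒m<n∨m≡n i≤n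
... | inj₁ i<n  = ≤-trans (term≤sum< n f i<n) (m≤n+m _ (f n))
... | inj₂ refl = m≤m+n (f n) _

below-average : ∀ n (f : ℕ → ℕ) c → sum< n f < n * c → ∃[ i ] f i < c
below-average (suc n) f c lt with f n <? c
... | yes fn<c = n , fn<c
... | no  fn≮c = below-average n f c
  (+-cancelˡ-< c _ _ (≤-<-trans (+-monoˡ-≤ _ (≮⇒≥ fn≮c)) lt))

-- The growth budget `n` is split between the next run and all later ones.
splits : ℕ → (ℕ → ℕ → ℕ) → ℕ
splits zero    f = f 0 0
splits (suc n) f = f 0 (suc n) + splits n (λ i j → f (suc i) j)

splits-mono : ∀ n {f g : ℕ → ℕ → ℕ} → (∀ i j → i + j ≡ n → f i j ≤ g i j) →
              splits n f ≤ splits n g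
splits-mono zero    le = le 0 0 refl
splits-mono (suc n) le =
  +-mono-≤ (le 0 (suc n) refl) (splits-mono n λ i j eq → le (suc i) j (cong suc eq))

splits-cong : ∀ n {f g : ℕ → ℕ → ℕ} → (∀ i j → f i j ≡ g i j) → splits n f ≡ splits n g
splits-cong zero    eq = eq 0 0
splits-cong (suc n) eq = cong₂ _+_ (eq 0 (suc n)) (splits-cong n λ i j → eq (suc i) j)

splits-* : ∀ n c (f : ℕ → ℕ → ℕ) → c * splits n f ≡ splits n (λ i j → c * f i j)
splits-* zero    c f = refl
splits-* (suc n) c f =
  trans (*-distribˡ-+ c (f 0 (suc n)) _) (cong (λ z → c * f 0 (suc n) + z) (splits-* n c _))

term≤splits : ∀ i j (f : ℕ → ℕ → ℕ) → f i j ≤ splits (i + j) f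
term≤splits zero    zero    f = ≤-refl
term≤splits zero    (suc j) f = m≤m+n _ _
term≤splits (suc i) j       f = ≤-trans (term≤splits i j (λ i j → f (suc i) j)) (m≤n+m _ (f 0 (suc (i + j))))

-- Σ_{i+j=n} (a+i)·16^j, compared with the infinite series Σ_i (a+i)/16^i = 16a/15 + 16/225.
splits-geometric : ∀ n a → 15 * splits n (λ i j → (a + i) * 16 ^ j) ≤ (16 * a + 2) * 16 ^ n
splits-geometric zero a = ≤-trans (m≤m+n _ (a + 2)) (≤-reflexive (eq a))
  where
  eq : ∀ a → 15 * ((a + 0) * 1) + (a + 2) ≡ (16 * a + 2) * 1
  eq = solve-∀
splits-geometric (suc n) a = begin
  15 * ((a + 0) * 16 ^ suc n + splits n (λ i j → (a + suc i) * 16 ^ j))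
    ≡⟨ cong (λ s → 15 * ((a + 0) * 16 ^ suc n + s))
            (splits-cong n λ i j → cong (_* 16 ^ j) (+-suc a i)) ⟩
  15 * ((a + 0) * 16 ^ suc n + splits n (λ i j → (suc a + i) * 16 ^ j))
    ≡⟨ *-distribˡ-+ 15 ((a + 0) * 16 ^ suc n) _ ⟩
  15 * ((a + 0) * 16 ^ suc n) + 15 * splits n (λ i j → (suc a + i) * 16 ^ j)
    ≤⟨ +-monoʳ-≤ (15 * ((a + 0) * 16 ^ suc n)) (splits-geometric n (suc a)) ⟩
  15 * ((a + 0) * (16 * 16 ^ n)) + (16 * suc a + 2) * 16 ^ n
    ≤⟨ m≤m+n _ (14 * 16 ^ n) ⟩
  15 * ((a + 0) * (16 * 16 ^ n)) + (16 * suc a + 2) * 16 ^ n + 14 * 16 ^ n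
    ≡⟨ eq a (16 ^ n) ⟩
  (16 * a + 2) * (16 * 16 ^ n) ∎
  where
  open ≤-Reasoning
  eq : ∀ a x → 15 * ((a + 0) * (16 * x)) + (16 * (1 + a) + 2) * x + 14 * x ≡ (16 * a + 2) * (16 * x)
  eq = solve-∀

-- Averaging over words with letters below P

_∷_ : ℕ → (ℕ → ℕ) → ℕ → ℕ
(a ∷ t) zero    = a
(a ∷ t) (suc i) = t i

module Words (P : ℕ) where

  -- Expectation over a uniform word, times `P ^ M`; words are continued by zeros.
  sumWords : ℕ → ((ℕ → ℕ) → ℕ) → ℕ
  sumWords zero    F = F (λ _ → 0)
  sumWords (suc M) F = sum< P λ a → sumWords M λ t → F (a ∷ t)

  sumWords-cong : ∀ M {F H : (ℕ → ℕ) → ℕ} → (∀ t → F t ≡ H t) → sumWords M F ≡ sumWords M H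
  sumWords-cong zero    eq = eq _
  sumWords-cong (suc M) eq = sum<-cong P λ a → sumWords-cong M λ t → eq (a ∷ t)

  sumWords-+ : ∀ M (F H : (ℕ → ℕ) → ℕ) →
               sumWords M (λ t → F t + H t) ≡ sumWords M F + sumWords M H
  sumWords-+ zero    F H = refl
  sumWords-+ (suc M) F H = trans (sum<-cong P λ a → sumWords-+ M _ _) (sum<-+ P _ _)

  sumWords-1 : ∀ M → sumWords M (λ _ → 1) ≡ P ^ M
  sumWords-1 zero    = refl
  sumWords-1 (suc M) = trans (sum<-cong P λ _ → sumWords-1 M) (sum<-const P (P ^ M))

  sumWords-0 : ∀ M → sumWords M (λ _ → 0) ≡ 0
  sumWords-0 zero    = refl
  sumWords-0 (suc M) = trans (sum<-cong P λ _ → sumWords-0 M) (trans (sum<-const P 0) (*-zeroʳ P))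

  sumWords-sum< : ∀ M n (F : ℕ → (ℕ → ℕ) → ℕ) →
                  sumWords M (λ t → sum< n λ i → F i t) ≡ sum< n λ i → sumWords M (F i)
  sumWords-sum< M zero    F = sumWords-0 M
  sumWords-sum< M (suc n) F =
    trans (sumWords-+ M (F n) _) (cong (λ z → sumWords M (F n) + z) (sumWords-sum< M n F))

  sumWords-splits : ∀ M n (F : ℕ → ℕ → (ℕ → ℕ) → ℕ) →
    sumWords M (λ t → splits n λ i j → F i j t) ≡ splits n λ i j → sumWords M (F i j)
  sumWords-splits M zero    F = refl
  sumWords-splits M (suc n) F =
    trans (sumWords-+ M (F 0 (suc n)) _)
          (cong (λ z → sumWords M (F 0 (suc n)) + z) (sumWords-splits M n λ i j → F (suc i) j))

  sumWords-sum<-≤ : ∀ M n c {B} (F : ℕ → (ℕ → ℕ) → ℕ) →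
    (∀ i → i < n → c * sumWords M (F i) ≤ B) → c * sumWords M (λ t → sum< n λ i → F i t) ≤ n * B
  sumWords-sum<-≤ M n c {B} F le = begin
    c * sumWords M (λ t → sum< n λ i → F i t)  ≡⟨ cong (c *_) (sumWords-sum< M n F) ⟩
    c * sum< n (λ i → sumWords M (F i))        ≡⟨ sum<-* n c _ ⟩
    sum< n (λ i → c * sumWords M (F i))        ≤⟨ sum<-mono n le ⟩
    sum< n (λ _ → B)                           ≡⟨ sum<-const n B ⟩
    n * B ∎
    where open ≤-Reasoning

  -- First moment method: an average below 1 forces the value 0, and letters are chosen one by one
  -- to keep the average below 1.
  vanishing-word : ∀ M F → sumWords M F < P ^ M → ∃[ t ] F t ≡ 0
  vanishing-word zero    F lt = _ , n<1⇒n≡0 lt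
  vanishing-word (suc M) F lt with below-average P _ (P ^ M) lt
  ... | a , lt′ with vanishing-word M (λ t → F (a ∷ t)) lt′
  ... | t , eq = (a ∷ t) , eq

  DependsFrom : ℕ → ((ℕ → ℕ) → ℕ) → Set
  DependsFrom b F = ∀ t t′ → (∀ i → b ≤ i → t i ≡ t′ i) → F t ≡ F t′

  -- Two letters are tested because adjacent cells can lie in adjacent superblocks; see
  -- `missing-nearby`.
  matches : ℕ → (ℕ → ℕ) → ℕ → Bool
  matches a t s = (t s ≡ᵇ a) ∧ (t (suc s) ≡ᵇ a)

  match mismatch : ℕ → (ℕ → ℕ) → ℕ → ℕ
  match    a t s = if matches a t s then 1 else 0
  mismatch a t s = if matches a t s then 0 else 1

  mismatch+match : ∀ a t s x → mismatch a t s * x + match a t s * x ≡ x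
  mismatch+match a t s x with matches a t s
  ... | true  = +-identityʳ x
  ... | false = trans (+-identityʳ _) (+-identityʳ x)

  ≡ᵇ-refl : ∀ a → (a ≡ᵇ a) ≡ true
  ≡ᵇ-refl zero    = refl
  ≡ᵇ-refl (suc a) = ≡ᵇ-refl a

  mismatch-1 : ∀ a t s → (t s ≡ a → t (suc s) ≡ a → ⊥) → mismatch a t s ≡ 1
  mismatch-1 a t s no-match with t s ≡ᵇ a in eq | t (suc s) ≡ᵇ a in eq′
  ... | false | _     = refl
  ... | true  | false = refl
  ... | true  | true  = ⊥-elim (no-match (≡ᵇ⇒≡ (t s) a (subst True (sym eq) _))
                                         (≡ᵇ⇒≡ (t (suc s)) a (subst True (sym eq′) _)))

  -- `F` ignores letters `s` and `suc s`, so their `P * P` values contribute equally, and one of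
  -- them is a match.
  match-often : ∀ s M a F → suc (suc s) ≤ M → a < P → DependsFrom (suc (suc s)) F →
                sumWords M F ≤ P * P * sumWords M (λ t → match a t s * F t)
  match-often zero (suc (suc M)) a F (s≤s (s≤s _)) a<P dep = begin
    sum< P (λ i → sum< P λ j → sumWords M λ t → F (i ∷ (j ∷ t)))
      ≡⟨ sum<-cong P (λ i → sum<-cong P λ j → sumWords-cong M λ t →
           dep _ _ λ { (suc (suc _)) _ → refl ; (suc zero) (s≤s ()) }) ⟩
    sum< P (λ _ → sum< P λ _ → C)
      ≡⟨ trans (sum<-cong P λ _ → sum<-const P C) (sum<-const P (P * C)) ⟩
    P * (P * C)                  ≡⟨ *-assoc P P C ⟨
    P * P * C                    ≡⟨ cong (P * P *_) (sumWords-cong M λ t → matching t) ⟩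
    P * P * summand a a             ≤⟨ *-monoʳ-≤ (P * P) (≤-trans (term≤sum< P (summand a) a<P)
                                      (term≤sum< P (λ i → sum< P (summand i)) a<P)) ⟩
    P * P * sum< P (λ i → sum< P (summand i)) ∎
    where
    open ≤-Reasoning
    C = sumWords M λ t → F (a ∷ (a ∷ t))
    summand : ℕ → ℕ → ℕ
    summand i j = sumWords M λ t → match a (i ∷ (j ∷ t)) 0 * F (i ∷ (j ∷ t))
    matching : ∀ t → F (a ∷ (a ∷ t)) ≡ match a (a ∷ (a ∷ t)) 0 * F (a ∷ (a ∷ t))
    matching t rewrite ≡ᵇ-refl a = sym (+-identityʳ _)
  match-often (suc s) (suc M) a F (s≤s s<M) a<P dep = begin
    sum< P (λ i → sumWords M λ t → F (i ∷ t))
      ≤⟨ sum<-mono P (λ i _ → match-often s M a (λ t → F (i ∷ t)) s<M a<P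
           λ t t′ eq → dep _ _ λ { (suc j) (s≤s b≤j) → eq j b≤j }) ⟩
    sum< P (λ i → P * P * sumWords M λ t → match a t s * F (i ∷ t))
      ≡⟨ sum<-* P (P * P) _ ⟨
    P * P * sum< P (λ i → sumWords M λ t → match a t s * F (i ∷ t)) ∎
    where open ≤-Reasoning

  mismatch-rarely : ∀ s M a F → suc (suc s) ≤ M → a < P → DependsFrom (suc (suc s)) F →
    P * P * sumWords M (λ t → mismatch a t s * F t) ≤ (P * P ∸ 1) * sumWords M F
  mismatch-rarely s M a F s<M a<P dep = begin
    P * P * I                        ≡⟨ m+n∸n≡m (P * P * I) S ⟨
    P * P * I + S ∸ S                ≤⟨ ∸-monoˡ-≤ S (+-monoʳ-≤ (P * P * I) (match-often s M a F s<M a<P dep)) ⟩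
    P * P * I + P * P * I′ ∸ S       ≡⟨ cong (_∸ S) (*-distribˡ-+ (P * P) I I′) ⟨
    P * P * (I + I′) ∸ S             ≡⟨ cong₂ (λ x y → P * P * x ∸ y) I+I′≡S (sym (*-identityˡ S)) ⟩
    P * P * S ∸ 1 * S                ≡⟨ *-distribʳ-∸ S (P * P) 1 ⟨
    (P * P ∸ 1) * S ∎
    where
    open ≤-Reasoning
    I  = sumWords M λ t → mismatch a t s * F t
    I′ = sumWords M λ t → match a t s * F t
    S  = sumWords M F
    I+I′≡S : I + I′ ≡ S
    I+I′≡S = trans (sym (sumWords-+ M _ _)) (sumWords-cong M λ t → mismatch+match a t s (F t))

-- Counting the discretised waves

module Paths (P u h : ℕ) {{P≢0 : NonZero P}} {{u≢0 : NonZero u}} {{h≢0 : NonZero h}} where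

  open Words P

  -- A run makes `u` tests, `2 * P` steps apart. Gaps known up to `h` let a position drift by at
  -- most `q` in `T` steps; an equal uncertainty at the start gives windows of length `L = 2 * q`.
  T q L : ℕ
  T = 2 * P * u
  q = T * h
  L = 2 * q

  instance
    T≢0 : NonZero T
    T≢0 = m*n≢0 (2 * P) u {{m*n≢0 2 P}}
    q≢0 : NonZero q
    q≢0 = m*n≢0 T h
    L≢0 : NonZero L
    L≢0 = m*n≢0 2 q

  superblock : ℕ → ℕ
  superblock y = y ÷ L ÷ P

  superblock-mono : ∀ {y z} → y ≤ z → superblock y ≤ superblock z
  superblock-mono y≤z = /-monoˡ-≤ P (/-monoˡ-≤ L y≤z)

  -- Sites two superblocks apart read disjoint pairs of letters, which makes their tests
  -- independent.
  superblock-skip : ∀ y {δ} → 2 * P * L ≤ δ → 2 + superblock y ≤ superblock (y + δ)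
  superblock-skip y {δ} le = begin
    2 + y ÷ L ÷ P                ≡⟨ cong (_+ y ÷ L ÷ P) (m*n/n≡m 2 P) ⟨
    2 * P ÷ P + y ÷ L ÷ P        ≡⟨ +-distrib-/-∣ˡ (y ÷ L) (divides 2 refl) ⟨
    (2 * P + y ÷ L) ÷ P          ≡⟨ cong (λ z → (z + y ÷ L) ÷ P) (m*n/n≡m (2 * P) L) ⟨
    (2 * P * L ÷ L + y ÷ L) ÷ P  ≡⟨ cong (_÷ P) (+-distrib-/-∣ˡ y (divides (2 * P) refl)) ⟨
    (2 * P * L + y) ÷ L ÷ P      ≤⟨ superblock-mono (≤-trans (+-monoˡ-≤ y le) (≤-reflexive (+-comm δ y))) ⟩
    superblock (y + δ) ∎
    where open ≤-Reasoning

  -- A crude bound that is enough to choose the word length `M`.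
  superblock-q : ∀ z → superblock (z * q) ≤ z
  superblock-q z = begin
    z * q ÷ L ÷ P  ≤⟨ m/n≤m (z * q ÷ L) P ⟩
    z * q ÷ L      ≤⟨ /-monoʳ-≤ (z * q) (m≤m+n q _) ⟩
    z * q ÷ q      ≡⟨ m*n/n≡m z q ⟩
    z ∎
    where open ≤-Reasoning

  stride : ℕ → ℕ
  stride D = 2 * P * (D * h)

  stride-large : ∀ {D} → 2 * T ≤ D → 2 * P * L ≤ stride D
  stride-large {D} 2T≤D = *-monoʳ-≤ (2 * P)
    (≤-trans (≤-reflexive (sym (*-assoc 2 T h))) (*-monoˡ-≤ h 2T≤D))

  module _ (phase : ℕ → ℕ) where

    avoids : ℕ → ℕ → ℕ → (ℕ → ℕ) → ℕ
    avoids zero    δ y t = 1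
    avoids (suc v) δ y t = mismatch (phase y) t (superblock y) * avoids v δ (y + δ) t

    -- A run whose gap stays in [D h, (D+1) h) is pinned down well enough to be tested.
    survives : ℕ → ℕ → ℕ → (ℕ → ℕ) → ℕ
    survives zero    X D t = avoids u (stride D) (X * q) t
    survives (suc _) X D t = 1

    -- Records of J runs from position X (unit q) and gap D (unit h) with total growth at most G.
    paths : ℕ → ℕ → ℕ → ℕ → (ℕ → ℕ) → ℕ
    paths zero    X D G t = 1
    paths (suc J) X D G t = splits G λ g G′ → sum< (2 + g) λ e →
      survives g X D t * paths J (X + D + e) (D + g) G′ t

    avoids-depends : ∀ v δ y → DependsFrom (superblock y) (avoids v δ y)
    avoids-depends zero    δ y t t′ eq = refl
    avoids-depends (suc v) δ y t t′ eq
      rewrite eq (superblock y) ≤-refl | eq (suc (superblock y)) (n≤1+n _)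
            | avoids-depends v δ (y + δ) t t′ (λ i le → eq i (≤-trans (superblock-mono (m≤m+n y δ)) le))
      = refl

    survives-depends : ∀ g X D → DependsFrom (superblock (X * q)) (survives g X D)
    survives-depends zero    X D = avoids-depends u (stride D) (X * q)
    survives-depends (suc g) X D t t′ eq = refl

    -- Positions never decrease, so a record is independent of the letters of earlier superblocks.
    paths-depends : ∀ J X D G → DependsFrom (superblock (X * q)) (paths J X D G)
    paths-depends zero    X D G t t′ eq = refl
    paths-depends (suc J) X D G t t′ eq = splits-cong G λ g G′ → sum<-cong (2 + g) λ e →
      cong₂ _*_ (survives-depends g X D t t′ eq)
                (paths-depends J (X + D + e) (D + g) G′ t t′ λ i le → eq i (≤-trans
                  (superblock-mono (*-monoˡ-≤ q (≤-trans (m≤m+n X D) (m≤m+n (X + D) e)))) le))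

    module _ (phase<P : ∀ y → phase y < P) where

      -- The later tests and `F` read letters at least two superblocks further on, so
      -- `mismatch-rarely` gives one factor per test.
      avoids-rarely : ∀ v δ y M F → 2 * P * L ≤ δ → superblock (y + v * δ) ≤ M →
        DependsFrom (superblock (y + v * δ)) F →
        (P * P) ^ v * sumWords M (λ t → avoids v δ y t * F t) ≤ (P * P ∸ 1) ^ v * sumWords M F
      avoids-rarely zero δ y M F _ _ _ =
        *-monoʳ-≤ 1 (≤-reflexive (sumWords-cong M λ t → *-identityˡ (F t)))
      avoids-rarely (suc v) δ y M F large ≤M dep = begin
        A * A ^ v * sumWords M (λ t → mismatch a t s * avoids v δ (y + δ) t * F t)
          ≡⟨ cong (A * A ^ v *_) (sumWords-cong M λ t → *-assoc (mismatch a t s) _ _) ⟩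
        A * A ^ v * sumWords M (λ t → mismatch a t s * F′ t)
          ≡⟨ swap A (A ^ v) _ ⟩
        A ^ v * (A * sumWords M (λ t → mismatch a t s * F′ t))
          ≤⟨ *-monoʳ-≤ (A ^ v) (mismatch-rarely s M a F′ s+2≤M (phase<P y) dep′) ⟩
        A ^ v * ((A ∸ 1) * sumWords M F′)
          ≡⟨ swap′ (A ^ v) (A ∸ 1) _ ⟩
        (A ∸ 1) * (A ^ v * sumWords M F′)
          ≤⟨ *-monoʳ-≤ (A ∸ 1) (avoids-rarely v δ (y + δ) M F large
               (subst (λ z → superblock z ≤ M) assoc ≤M)
               (subst (λ z → DependsFrom (superblock z) F) assoc dep)) ⟩
        (A ∸ 1) * ((A ∸ 1) ^ v * sumWords M F)
          ≡⟨ *-assoc (A ∸ 1) _ _ ⟨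
        (A ∸ 1) ^ suc v * sumWords M F ∎
        where
        open ≤-Reasoning
        A = P * P
        a = phase y
        s = superblock y
        F′ : (ℕ → ℕ) → ℕ
        F′ t = avoids v δ (y + δ) t * F t
        assoc : y + suc v * δ ≡ y + δ + v * δ
        assoc = sym (+-assoc y δ (v * δ))
        swap : ∀ a b c → a * b * c ≡ b * (a * c)
        swap = solve-∀
        swap′ : ∀ a b c → a * (b * c) ≡ b * (a * c)
        swap′ = solve-∀
        skip : 2 + s ≤ superblock (y + δ)
        skip = superblock-skip y large
        further : superblock (y + δ) ≤ superblock (y + suc v * δ)
        further = superblock-mono (+-monoʳ-≤ y (m≤m+n δ _))
        s+2≤M : 2 + s ≤ M
        s+2≤M = ≤-trans skip (≤-trans further ≤M)
        dep′ : DependsFrom (2 + s) F′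
        dep′ t t′ eq = cong₂ _*_
          (avoids-depends v δ (y + δ) t t′ λ i le → eq i (≤-trans skip le))
          (dep t t′ λ i le → eq i (≤-trans skip (≤-trans further le)))

      module _ (rare : 16 * (P * P ∸ 1) ^ u ≤ (P * P) ^ u) where

        run-rarely : ∀ X D M F → 2 * T ≤ D → X + D ≤ M → DependsFrom (superblock ((X + D) * q)) F →
          16 * sumWords M (λ t → survives 0 X D t * F t) ≤ sumWords M F
        run-rarely X D M F 2T≤D ≤M dep = *-cancelˡ-≤ (A ^ u) {{m^n≢0 A u {{m*n≢0 P P}}}} (begin
          A ^ u * (16 * S)          ≡⟨ swap (A ^ u) 16 S ⟩
          16 * (A ^ u * S)
            ≤⟨ *-monoʳ-≤ 16 (avoids-rarely u (stride D) (X * q) M F (stride-large 2T≤D)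
                 (≤-trans (≤-reflexive (cong superblock end)) (≤-trans (superblock-q (X + D)) ≤M))
                 (subst (λ z → DependsFrom (superblock z) F) (sym end) dep)) ⟩
          16 * ((A ∸ 1) ^ u * sumWords M F)  ≡⟨ *-assoc 16 ((A ∸ 1) ^ u) _ ⟨
          16 * (A ∸ 1) ^ u * sumWords M F    ≤⟨ *-monoˡ-≤ (sumWords M F) rare ⟩
          A ^ u * sumWords M F ∎)
          where
          open ≤-Reasoning
          A = P * P
          S = sumWords M λ t → survives 0 X D t * F t
          swap : ∀ a b c → a * (b * c) ≡ b * (a * c)
          swap = solve-∀
          identity : ∀ X D P u h → X * (2 * P * u * h) + u * (2 * P * (D * h)) ≡ (X + D) * (2 * P * u * h)
          identity = solve-∀
          -- The `u` strides advance by `D` units of `q`: the tests end at the earliest start of the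
          -- next run.
          end : X * q + u * stride D ≡ (X + D) * q
          end = identity X D P u h

        -- Bounds 16 times the expected number of successors with growth `g`: there are `2 + g`, and
        -- for `g = 0` the survival probability cancels the 16.
        weight : ℕ → ℕ
        weight zero    = 2
        weight (suc g) = 16 * (3 + g)

        -- `splits-geometric` with `a = 3` gives at most `2 + 50 / 15` times `16 ^ G`. The bound
        -- needed is 8, half of 16, which leaves a factor 1/2 per run.
        weight-total : ∀ G → splits G (λ g G′ → weight g * 16 ^ G′) ≤ 8 * 16 ^ G
        weight-total zero    = ≤ᵇ⇒≤ 2 8 _
        weight-total (suc G) = *-cancelˡ-≤ 15 (begin
          15 * (2 * x + splits G (λ g G′ → 16 * (3 + g) * 16 ^ G′))
            ≡⟨ cong (λ s → 15 * (2 * x + s)) (trans (splits-cong G λ g G′ → *-assoc 16 (3 + g) (16 ^ G′))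
                                                   (sym (splits-* G 16 λ g G′ → (3 + g) * 16 ^ G′))) ⟩
          15 * (2 * x + 16 * s)          ≡⟨ regroup x s ⟩
          30 * x + 16 * (15 * s)         ≤⟨ +-monoʳ-≤ (30 * x) (*-monoʳ-≤ 16 (splits-geometric G 3)) ⟩
          30 * x + 16 * (50 * 16 ^ G)    ≤⟨ m≤m+n _ (40 * (16 * 16 ^ G)) ⟩
          30 * (16 * 16 ^ G) + 16 * (50 * 16 ^ G) + 40 * (16 * 16 ^ G)  ≡⟨ collect (16 ^ G) ⟩
          15 * (8 * x) ∎)
          where
          open ≤-Reasoning
          x = 16 ^ suc G
          s = splits G λ g G′ → (3 + g) * 16 ^ G′
          regroup : ∀ x s → 15 * (2 * x + 16 * s) ≡ 30 * x + 16 * (15 * s)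
          regroup = solve-∀
          collect : ∀ y → 30 * (16 * y) + 16 * (50 * y) + 40 * (16 * y) ≡ 15 * (8 * (16 * y))
          collect = solve-∀

        -- Induction on `J`, with growth `g` paid for by `16 ^ g`. The hypothesis on `M` keeps all
        -- letters read inside the word.
        few-paths : ∀ J X D G M → 2 * T ≤ D → X + J * (D + G + 1) ≤ M →
          2 ^ J * sumWords M (paths J X D G) ≤ 16 ^ G * P ^ M
        few-paths zero X D G M _ _ = begin
          1 * sumWords M (λ _ → 1)  ≡⟨ trans (*-identityˡ _) (sumWords-1 M) ⟩
          P ^ M                     ≤⟨ m≤n*m (P ^ M) (16 ^ G) {{m^n≢0 16 G}} ⟩
          16 ^ G * P ^ M ∎
          where open ≤-Reasoning
        few-paths (suc J) X D G M 2T≤D ≤M = *-cancelˡ-≤ 8 (begin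
          8 * (2 * 2 ^ J * sumWords M (paths (suc J) X D G))
            ≡⟨ regroup (2 ^ J) _ ⟩
          c * sumWords M (paths (suc J) X D G)
            ≡⟨ cong (c *_) (sumWords-splits M G _) ⟩
          c * splits G (λ g G′ → runs g G′)
            ≡⟨ splits-* G c _ ⟩
          splits G (λ g G′ → c * runs g G′)
            ≤⟨ splits-mono G bound ⟩
          splits G (λ g G′ → P ^ M * (weight g * 16 ^ G′))
            ≡⟨ splits-* G (P ^ M) _ ⟨
          P ^ M * splits G (λ g G′ → weight g * 16 ^ G′)
            ≤⟨ *-monoʳ-≤ (P ^ M) (weight-total G) ⟩
          P ^ M * (8 * 16 ^ G)
            ≡⟨ regroup′ (P ^ M) (16 ^ G) ⟩
          8 * (16 ^ G * P ^ M) ∎)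
          where
          open ≤-Reasoning
          c = 16 * 2 ^ J
          runs : ℕ → ℕ → ℕ
          runs g G′ = sumWords M λ t → sum< (2 + g) λ e →
            survives g X D t * paths J (X + D + e) (D + g) G′ t
          regroup : ∀ a s → 8 * (2 * a * s) ≡ 16 * a * s
          regroup = solve-∀
          regroup′ : ∀ a b → a * (8 * b) ≡ 8 * (b * a)
          regroup′ = solve-∀
          swap : ∀ a s → 16 * a * s ≡ a * (16 * s)
          swap = solve-∀
          fits : ∀ g G′ e → g + G′ ≡ G → e ≤ suc g → X + D + e + J * (D + g + G′ + 1) ≤ M
          fits g G′ e refl e≤1+g = ≤-trans (begin
            X + D + e + J * (D + g + G′ + 1)
              ≤⟨ +-monoˡ-≤ _ (+-monoʳ-≤ (X + D) (≤-trans e≤1+g (m≤m+n (suc g) G′))) ⟩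
            X + D + (suc g + G′) + J * (D + g + G′ + 1)
              ≡⟨ identity X D g G′ J ⟩
            X + suc J * (D + (g + G′) + 1) ∎) ≤M
            where
            identity : ∀ X D g G′ J → X + D + (1 + g + G′) + J * (D + g + G′ + 1)
                                    ≡ X + (1 + J) * (D + (g + G′) + 1)
            identity = solve-∀
          rest : ∀ g G′ e → g + G′ ≡ G → e < 2 + g →
                 2 ^ J * sumWords M (paths J (X + D + e) (D + g) G′) ≤ 16 ^ G′ * P ^ M
          rest g G′ e eq e<2+g = few-paths J (X + D + e) (D + g) G′ M
            (≤-trans 2T≤D (m≤m+n D g)) (fits g G′ e eq (≤-pred e<2+g))
          bound : ∀ g G′ → g + G′ ≡ G → c * runs g G′ ≤ P ^ M * (weight g * 16 ^ G′)
          bound zero G′ eq = ≤-trans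
            (sumWords-sum<-≤ M 2 c _ λ e e<2 → begin
              c * sumWords M (λ t → survives 0 X D t * paths J (X + D + e) (D + 0) G′ t)
                ≡⟨ swap (2 ^ J) _ ⟩
              2 ^ J * (16 * sumWords M (λ t → survives 0 X D t * paths J (X + D + e) (D + 0) G′ t))
                ≤⟨ *-monoʳ-≤ (2 ^ J) (run-rarely X D M (paths J (X + D + e) (D + 0) G′) 2T≤D X+D≤M
                     λ t t′ eq → paths-depends J (X + D + e) (D + 0) G′ t t′ λ i le →
                       eq i (≤-trans (superblock-mono (*-monoˡ-≤ q (m≤m+n (X + D) e))) le)) ⟩
              2 ^ J * sumWords M (paths J (X + D + e) (D + 0) G′)
                ≤⟨ rest 0 G′ e eq e<2 ⟩
              16 ^ G′ * P ^ M ∎)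
            (≤-reflexive (identity (16 ^ G′) (P ^ M)))
            where
            identity : ∀ a b → 2 * (a * b) ≡ b * (2 * a)
            identity = solve-∀
            X+D≤M : X + D ≤ M
            X+D≤M = ≤-trans (≤-trans (m≤m+n (X + D) 0) (m≤m+n (X + D + 0) _)) (fits 0 G′ 0 eq z≤n)
          bound (suc g) G′ eq = ≤-trans
            (sumWords-sum<-≤ M (3 + g) c _ λ e e<3+g → begin
              c * sumWords M (λ t → 1 * paths J (X + D + e) (D + suc g) G′ t)
                ≡⟨ cong (c *_) (sumWords-cong M λ t → *-identityˡ (paths J (X + D + e) (D + suc g) G′ t)) ⟩
              c * sumWords M (paths J (X + D + e) (D + suc g) G′)
                ≡⟨ *-assoc 16 (2 ^ J) _ ⟩
              16 * (2 ^ J * sumWords M (paths J (X + D + e) (D + suc g) G′))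
                ≤⟨ *-monoʳ-≤ 16 (rest (suc g) G′ e eq e<3+g) ⟩
              16 * (16 ^ G′ * P ^ M) ∎)
            (≤-reflexive (identity g (16 ^ G′) (P ^ M)))
            where
            identity : ∀ g a b → (3 + g) * (16 * (a * b)) ≡ b * (16 * (3 + g) * a)
            identity = solve-∀

-- Waves given by a starting point and a gap sequence

pos : ℕ → (ℕ → ℕ) → ℕ → ℕ
pos x d zero    = x
pos x d (suc i) = pos x d i + d i

Monotone : (ℕ → ℕ) → Set
Monotone d = ∀ {i j} → i ≤ j → d i ≤ d j

pos-+ : ∀ x d i j → pos (pos x d i) (λ j → d (i + j)) j ≡ pos x d (i + j)
pos-+ x d i zero    = cong (pos x d) (sym (+-identityʳ i))
pos-+ x d i (suc j) = trans (cong (_+ d (i + j)) (pos-+ x d i j)) (cong (pos x d) (sym (+-suc i j)))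

pos-shift : ∀ a x d i → pos (a + x) d i ≡ a + pos x d i
pos-shift a x d zero    = refl
pos-shift a x d (suc i) = trans (cong (_+ d i) (pos-shift a x d i)) (+-assoc a _ _)

pos-lower : ∀ x d b → (∀ j → b ≤ d j) → ∀ i → x + i * b ≤ pos x d i
pos-lower x d b le zero    = ≤-reflexive (+-identityʳ x)
pos-lower x d b le (suc i) = ≤-trans (≤-reflexive (eq x b (i * b))) (+-mono-≤ (pos-lower x d b le i) (le i))
  where
  eq : ∀ x b c → x + (b + c) ≡ x + c + b
  eq = solve-∀

pos-upper : ∀ x d b i → (∀ j → j < i → d j ≤ b) → pos x d i ≤ x + i * b
pos-upper x d b zero    le = m≤m+n x 0
pos-upper x d b (suc i) le = ≤-trans
  (+-mono-≤ (pos-upper x d b i λ j j<i → le j (m<n⇒m<1+n j<i)) (le i ≤-refl)) (≤-reflexive (eq x b (i * b)))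
  where
  eq : ∀ x b c → x + c + b ≡ x + (b + c)
  eq = solve-∀

floor : ∀ n h {{_ : NonZero h}} → ∃[ z ] z * h ≤ n × n < suc z * h
floor n h = n ÷ h , m/n*n≤m n h , (begin-strict
  n                    ≡⟨ m≡m%n+[m/n]*n n h ⟩
  n % h + n ÷ h * h    <⟨ +-monoˡ-< (n ÷ h * h) (m%n<n n h) ⟩
  h + n ÷ h * h        ∎)
  where open ≤-Reasoning

-- Records left by actual waves

module _ (P u h : ℕ) {{P≢0 : NonZero P}} {{u≢0 : NonZero u}} {{h≢0 : NonZero h}} where
  open Words P
  open Paths P u h

  module _ (t phase : ℕ → ℕ) (Q : ℕ → Set)
           (hit : ∀ y w → y ≤ w → w < y + L → Q w →
                  t (superblock y) ≡ phase y → t (suc (superblock y)) ≡ phase y → ⊥) where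

    avoids-1 : ∀ v δ y → (∀ i → i < v → ∃[ w ] y + i * δ ≤ w × w < y + i * δ + L × Q w) →
               avoids phase v δ y t ≡ 1
    avoids-1 zero    δ y visit = refl
    avoids-1 (suc v) δ y visit = cong₂ _*_
      (mismatch-1 (phase y) t (superblock y)
        (let (w , lo , hi , Qw) = visit 0 z<s in
         hit y w (≤-trans (m≤m+n y 0) lo) (≤-trans hi (≤-reflexive (cong (_+ L) (+-identityʳ y)))) Qw))
      (avoids-1 v δ (y + δ) λ i i<v →
        let (w , lo , hi , Qw) = visit (suc i) (s≤s i<v) in
        w , ≤-trans (≤-reflexive (+-assoc y δ (i * δ))) lo ,
        ≤-trans hi (≤-reflexive (cong (_+ L) (sym (+-assoc y δ (i * δ))))) , Qw)

    -- The deterministic half: rounding position and gap down after each run gives a nonzero summand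
    -- of `paths`.
    wave-path : ∀ J x d X D G → Monotone d → X * q ≤ x → x < suc X * q →
      D * h ≤ d 0 → d 0 < suc D * h → d (J * T) < suc (D + G) * h →
      (∀ i → i < J * T → Q (pos x d i)) → 1 ≤ paths phase J X D G t
    wave-path zero    x d X D G mono X≤ <X D≤ <D <G Qs = ≤-refl
    wave-path (suc J) x d X D G mono X≤ <X D≤ <D <G Qs
      with floor (d T) h | floor (pos x d T) q
    ... | D′ , D′≤ , <D′ | X′ , X′≤ , <X′
      with m≤n⇒∃[o]m+o≡n D≤D′ | m≤n⇒∃[o]m+o≡n D′≤D+G | m≤n⇒∃[o]m+o≡n X+D≤X′
      where
      D≤D′ : D ≤ D′
      D≤D′ = ≤-pred (*-cancelʳ-< h D (suc D′) (≤-<-trans (≤-trans D≤ (mono z≤n)) <D′))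
      D′≤D+G : D′ ≤ D + G
      D′≤D+G = ≤-pred (*-cancelʳ-< h D′ (suc (D + G)) (≤-<-trans (≤-trans D′≤ (mono (m≤m+n T (J * T)))) <G))
      X+D≤X′ : X + D ≤ X′
      X+D≤X′ = ≤-pred (*-cancelʳ-< q (X + D) (suc X′) (≤-<-trans (begin
        (X + D) * (T * h)      ≡⟨ eq X D T h ⟩
        X * q + T * (D * h)    ≤⟨ +-monoˡ-≤ (T * (D * h)) X≤ ⟩
        x + T * (D * h)        ≤⟨ pos-lower x d (D * h) (λ j → ≤-trans D≤ (mono z≤n)) T ⟩
        pos x d T ∎) <X′))
        where
        open ≤-Reasoning
        eq : ∀ X D T h → (X + D) * (T * h) ≡ X * (T * h) + T * (D * h)
        eq = solve-∀
    ... | g , refl | G′ , D+g+G′≡D+G | e , refl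
      with +-cancelˡ-≡ D (g + G′) G (trans (sym (+-assoc D g G′)) D+g+G′≡D+G)
    ... | refl = ≤-trans (≤-trans (*-mono-≤ survived rest) (term≤sum< (2 + g) (path g G′) e<2+g))
                         (term≤splits g G′ (λ g G′ → sum< (2 + g) (path g G′)))
      where
      open ≤-Reasoning
      path : ℕ → ℕ → ℕ → ℕ
      path g G′ e = survives phase g X D t * paths phase J (X + D + e) (D + g) G′ t
      -- The start is known up to `q` and all gaps stay below `(D + g + 1) * h`, so `g + 2` values
      -- remain.
      e<2+g : e < 2 + g
      e<2+g = +-cancelˡ-< (X + D) e (2 + g) (*-cancelʳ-< q (X + D + e) (X + D + (2 + g)) (begin-strict
        (X + D + e) * q                           ≤⟨ X′≤ ⟩
        pos x d T                                 ≤⟨ pos-upper x d (suc (D + g) * h) T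
                                                      (λ j j<T → ≤-trans (mono (<⇒≤ j<T)) (<⇒≤ <D′)) ⟩
        x + T * (suc (D + g) * h)                 <⟨ +-monoˡ-< (T * (suc (D + g) * h)) <X ⟩
        suc X * (T * h) + T * (suc (D + g) * h)   ≡⟨ eq X D g T h ⟩
        (X + D + (2 + g)) * (T * h) ∎))
        where
        eq : ∀ X D g T h → (1 + X) * (T * h) + T * ((1 + (D + g)) * h) ≡ (X + D + (2 + g)) * (T * h)
        eq = solve-∀
      rest : 1 ≤ paths phase J (X + D + e) (D + g) G′ t
      rest = wave-path J (pos x d T) (λ j → d (T + j)) (X + D + e) (D + g) G′
        (λ i≤j → mono (+-monoʳ-≤ T i≤j)) X′≤ <X′
        (subst (λ z → (D + g) * h ≤ d z) (sym (+-identityʳ T)) D′≤)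
        (subst (λ z → d z < suc (D + g) * h) (sym (+-identityʳ T)) <D′)
        (subst (λ z → d (T + J * T) < suc z * h) (sym (+-assoc D g G′)) <G)
        λ i i<JT → subst Q (sym (pos-+ x d T i)) (Qs (T + i) (+-monoʳ-< T i<JT))
      survives-1 : ∀ g → d T < suc (D + g) * h → survives phase g X D t ≡ 1
      survives-1 (suc g) _  = refl
      -- Without growth, all gaps lie between `D * h` and `(D + 1) * h`, so after `j` steps the wave
      -- is past the site by less than `q + j * h`, which is at most `L`.
      survives-1 zero    <D = avoids-1 u (stride D) (X * q) λ i i<u →
        let j = i * (2 * P)
            j<T : j < T
            j<T = ≤-trans (*-monoˡ-< (2 * P) {{m*n≢0 2 P}} i<u) (≤-reflexive (*-comm u (2 * P)))
        in
        pos x d j ,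
        (begin
          X * q + i * (2 * P * (D * h))  ≡⟨ cong (λ z → X * q + z) (sym (*-assoc i (2 * P) (D * h))) ⟩
          X * q + j * (D * h)            ≤⟨ +-monoˡ-≤ (j * (D * h)) X≤ ⟩
          x + j * (D * h)                ≤⟨ pos-lower x d (D * h) (λ j → ≤-trans D≤ (mono z≤n)) j ⟩
          pos x d j ∎) ,
        (begin-strict
          pos x d j                               ≤⟨ pos-upper x d (suc (D + 0) * h) j
                                                      (λ j′ j′<j → ≤-trans (mono (<⇒≤ (<-trans j′<j j<T))) (<⇒≤ <D)) ⟩
          x + j * (suc (D + 0) * h)               <⟨ +-monoˡ-< (j * (suc (D + 0) * h)) <X ⟩
          suc X * q + j * (suc (D + 0) * h)       ≡⟨ eq X D j h q ⟩
          X * q + j * (D * h) + (q + j * h)       ≤⟨ +-monoʳ-≤ (X * q + j * (D * h)) (+-monoʳ-≤ q (*-monoˡ-≤ h (<⇒≤ j<T))) ⟩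
          X * q + j * (D * h) + (q + q)           ≡⟨ cong₂ (λ a b → X * q + a + b) (*-assoc i (2 * P) (D * h)) (cong (λ z → q + z) (sym (+-identityʳ q))) ⟩
          X * q + i * (2 * P * (D * h)) + L ∎) ,
        Qs j (≤-trans j<T (m≤m+n T (J * T)))
        where
        eq : ∀ X D j h q → (1 + X) * q + j * ((1 + (D + 0)) * h) ≡ X * q + j * (D * h) + (q + j * h)
        eq = solve-∀
      survived : 1 ≤ survives phase g X D t
      survived = ≤-reflexive (sym (survives-1 g <D′))

-- Adding a color

-- Positions count from 0 and colorings are total, so that cells can be read off with `÷` and `%`.
NoWave : ∀ {r} → (ℕ → Fin r) → ℕ → ℕ → Set
NoWave χ N k = ∀ c x d → Monotone d → 1 ≤ d 0 →
  (∀ i → i < k → pos x d i < N) → (∀ i → i < k → χ (pos x d i) ≡ c) → ⊥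

quotient-unique : ∀ {j w} L {{_ : NonZero L}} → j * L ≤ w → w < suc j * L → w ÷ L ≡ j
quotient-unique {j} {w} L lo hi = ≤-antisym
  (≤-pred (m<n*o⇒m/o<n hi))
  (≤-trans (≤-reflexive (sym (m*n/n≡m j L))) (/-monoˡ-≤ L lo))

module Phases (r : ℕ) where

  R P : ℕ
  R = suc r
  P = 2 * R

  -- A window of length `L` can meet two cells, so the halving makes adjacent cells miss the same
  -- color in pairs; the letter shifts the pattern.
  missing : (ℕ → ℕ) → ℕ → Fin R
  missing t j = ((j + t (j ÷ P)) ÷ 2) mod R

  -- This is `2 * c - b` modulo `P`, with `P ∸ 1` in place of -1.
  residue : ℕ → ℕ → ℕ
  residue c b = (2 * c + (P ∸ 1) * b) % P

  residue<P : ∀ c b → residue c b < P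
  residue<P c b = m%n<n (2 * c + (P ∸ 1) * b) P

  residue-+ : ∀ (c : Fin R) b → (residue (toℕ c) b + b) % P ≡ 2 * toℕ c
  residue-+ c b = begin
    (a % P + b) % P                ≡⟨ %-distribˡ-+ (a % P) b P ⟩
    (a % P % P + b % P) % P        ≡⟨ cong (λ z → (z + b % P) % P) (m%n%n≡m%n a P) ⟩
    (a % P + b % P) % P            ≡⟨ %-distribˡ-+ a b P ⟨
    (a + b) % P                    ≡⟨ cong (_% P) (identity (2 * toℕ c) (P ∸ 1) b) ⟩
    (2 * toℕ c + b * P) % P        ≡⟨ [m+kn]%n≡m%n (2 * toℕ c) b P ⟩
    2 * toℕ c % P                  ≡⟨ m<n⇒m%n≡m (*-monoʳ-< 2 (toℕ<n c)) ⟩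
    2 * toℕ c ∎
    where
    open ≡-Reasoning
    a = 2 * toℕ c + (P ∸ 1) * b
    identity : ∀ z p b → z + p * b + b ≡ z + b * (1 + p)
    identity = solve-∀

  -- Modulo `P` the number to be halved is `2 * c + ε`, and `ε` is at most 1, so halving removes it.
  missing-≡ : ∀ (c : Fin R) t j ε b → ε < 2 → t ((ε + j) ÷ P) ≡ b → (j + b) % P ≡ 2 * toℕ c →
              missing t (ε + j) ≡ c
  missing-≡ c t j ε b ε<2 refl eq = toℕ-injective (begin
    toℕ (missing t (ε + j))             ≡⟨ toℕ-fromℕ< _ ⟩
    (ε + j + b′) ÷ 2 % R                ≡⟨ cong (λ w → w ÷ 2 % R) (begin
      ε + j + b′                          ≡⟨ +-assoc ε j b′ ⟩
      ε + (j + b′)                        ≡⟨ cong (λ z → ε + z) (m≡m%n+[m/n]*n (j + b′) P) ⟩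
      ε + ((j + b′) % P + z * P)          ≡⟨ cong (λ w → ε + (w + z * P)) eq ⟩
      ε + (2 * toℕ c + z * (2 * R))       ≡⟨ identity ε (toℕ c) z R ⟩
      ε + (toℕ c + z * R) * 2             ∎) ⟩
    (ε + (toℕ c + z * R) * 2) ÷ 2 % R   ≡⟨ cong (_% R) (+-distrib-/-∣ʳ ε (divides (toℕ c + z * R) refl)) ⟩
    (ε ÷ 2 + (toℕ c + z * R) * 2 ÷ 2) % R
      ≡⟨ cong₂ (λ v w → (v + w) % R) (m<n⇒m/n≡0 ε<2) (m*n/n≡m (toℕ c + z * R) 2) ⟩
    (toℕ c + z * R) % R                 ≡⟨ [m+kn]%n≡m%n (toℕ c) z R ⟩
    toℕ c % R                           ≡⟨ m<n⇒m%n≡m (toℕ<n c) ⟩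
    toℕ c ∎)
    where
    open ≡-Reasoning
    b′ = t ((ε + j) ÷ P)
    z = (j + b′) ÷ P
    identity : ∀ ε c z R → ε + (2 * c + z * (2 * R)) ≡ ε + (c + z * R) * 2
    identity = solve-∀

  -- The `P` cells of a superblock take every residue modulo `P`, so each color is missing in one of
  -- them, whatever the word. This drives `gap-grows`.
  missing-cell : ∀ c t s → ∃[ j ] s * P ≤ j × j < suc s * P × missing t j ≡ c
  missing-cell c t s = j , m≤n+m (s * P) ρ , j< ,
    missing-≡ c t j 0 (t s) (s≤s z≤n)
      (cong t (quotient-unique P (m≤n+m (s * P) ρ) j<)) (begin
      (ρ + s * P + t s) % P    ≡⟨ cong (_% P) (swap ρ (s * P) (t s)) ⟩
      (ρ + t s + s * P) % P    ≡⟨ [m+kn]%n≡m%n (ρ + t s) s P ⟩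
      (ρ + t s) % P            ≡⟨ residue-+ c (t s) ⟩
      2 * toℕ c ∎)
    where
    open ≡-Reasoning
    ρ = residue (toℕ c) (t s)
    j = ρ + s * P
    j< : j < suc s * P
    j< = +-monoˡ-< (s * P) (residue<P (toℕ c) (t s))
    swap : ∀ a b c → a + b + c ≡ a + c + b
    swap = solve-∀

  -- Cell `suc j` may belong to the next superblock; requiring the same value of both letters covers
  -- that case.
  missing-nearby : ∀ c t j ε → ε < 2 → t (j ÷ P) ≡ residue (toℕ c) j →
    t (suc (j ÷ P)) ≡ residue (toℕ c) j → missing t (ε + j) ≡ c
  missing-nearby c t j ε ε<2 eq₀ eq₁ = missing-≡ c t j ε (residue (toℕ c) j) ε<2 same
    (trans (cong (_% P) (+-comm j _)) (residue-+ c j))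
    where
    open ≤-Reasoning
    near : (ε + j) ÷ P ≤ suc (j ÷ P)
    near = begin
      (ε + j) ÷ P   ≤⟨ /-monoˡ-≤ P (+-monoˡ-≤ j (≤-trans (<⇒≤ ε<2) (m≤m*n 2 R))) ⟩
      (P + j) ÷ P   ≡⟨ +-distrib-/-∣ˡ j (divides 1 (sym (*-identityˡ P))) ⟩
      P ÷ P + j ÷ P ≡⟨ cong (_+ j ÷ P) (n/n≡1 P) ⟩
      suc (j ÷ P) ∎
    same : t ((ε + j) ÷ P) ≡ residue (toℕ c) j
    same with (ε + j) ÷ P ≟ suc (j ÷ P)
    ... | yes eq = trans (cong t eq) eq₁
    ... | no neq = trans (cong t (≤-antisym (≤-pred (≤∧≢⇒< near neq)) (/-monoˡ-≤ P (m≤n+m j ε)))) eq₀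

module Level (r u h : ℕ) {{u≢0 : NonZero u}} {{h≢0 : NonZero h}}
             (rare : 16 * (2 * suc r * (2 * suc r) ∸ 1) ^ u ≤ (2 * suc r * (2 * suc r)) ^ u)
             (φ : ℕ → Fin r) (m : ℕ) where

  open Phases r
  open Words P
  open Paths P u h

  χ : (ℕ → ℕ) → ℕ → Fin R
  χ t x = punchIn (missing t (x ÷ L)) (φ (x % L))

  phase : ℕ → ℕ → ℕ
  phase c y = residue c (y ÷ L)

  -- The window meets only the cell of `y` and the next one; both miss `c`, a color `punchIn` then
  -- never takes.
  hit : ∀ t c y w → y ≤ w → w < y + L → χ t w ≡ c → t (superblock y) ≡ phase (toℕ c) y →
        t (suc (superblock y)) ≡ phase (toℕ c) y → ⊥
  hit t c y w y≤w w<y+L χw≡c eq₀ eq₁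
    with m≤n⇒∃[o]m+o≡n (/-monoˡ-≤ L y≤w)
  ... | ε , j+ε≡ = punchInᵢ≢i _ _ (trans χw≡c (sym (trans (cong (missing t) cell)
      (missing-nearby c t (y ÷ L) ε ε<2 eq₀ eq₁))))
    where
    open ≤-Reasoning
    cell : w ÷ L ≡ ε + y ÷ L
    cell = trans (sym j+ε≡) (+-comm (y ÷ L) ε)
    ε<2 : ε < 2
    ε<2 = +-cancelʳ-< (y ÷ L) ε 2 (begin-strict
      ε + y ÷ L    ≡⟨ cell ⟨
      w ÷ L        <⟨ m<n*o⇒m/o<n (<-≤-trans w<y+L (begin
        y + L               ≤⟨ +-monoˡ-≤ L (<⇒≤ (proj₂ (proj₂ (floor y L)))) ⟩
        suc (y ÷ L) * L + L ≡⟨ +-comm _ L ⟩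
        (2 + y ÷ L) * L ∎)) ⟩
      2 + y ÷ L ∎)

  module _ (J G K : ℕ) where

    N : ℕ
    N = K * (G * h)

    -- Union bound over colors and rounded states once the gap has reached `L`, that is `2 * T`
    -- units of `h`.
    survivors : (ℕ → ℕ) → ℕ
    survivors t = sum< R λ c → sum< N λ X → sum< N λ D → paths (phase c) J X (2 * T + D) G t

    survivors-few : R * (N * N) * 16 ^ G < 2 ^ J → ∃[ t ] survivors t ≡ 0
    survivors-few small = vanishing-word M survivors (*-cancelˡ-< (2 ^ J) _ _ (begin-strict
      2 ^ J * sumWords M survivors
        ≤⟨ sumWords-sum<-≤ M R (2 ^ J) _ (λ c _ → sumWords-sum<-≤ M N (2 ^ J) _ λ X X<N →
             sumWords-sum<-≤ M N (2 ^ J) _ λ D D<N →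
               few-paths (phase c) (λ y → residue<P c (y ÷ L)) rare J X (2 * T + D) G M (m≤m+n (2 * T) D)
                 (+-mono-≤ (<⇒≤ X<N) (*-monoʳ-≤ J (+-monoˡ-≤ 1 (+-monoˡ-≤ G (+-monoʳ-≤ (2 * T) (<⇒≤ D<N))))))) ⟩
      R * (N * (N * (16 ^ G * P ^ M)))
        ≡⟨ identity R N (16 ^ G) (P ^ M) ⟩
      R * (N * N) * 16 ^ G * P ^ M
        <⟨ *-monoˡ-< (P ^ M) {{m^n≢0 P M}} small ⟩
      2 ^ J * P ^ M ∎))
      where
      open ≤-Reasoning
      M = N + J * (2 * T + N + G + 1)
      identity : ∀ R N a b → R * (N * (N * (a * b))) ≡ R * (N * N) * a * b
      identity = solve-∀

  module _ (noWave : NoWave φ L m) (t : ℕ → ℕ) (c : Fin R) (x : ℕ) (d : ℕ → ℕ)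
           (mono : Monotone d) (1≤d₀ : 1 ≤ d 0) where

    w : ℕ → ℕ
    w = pos x d

    w-mono : ∀ i b → w i ≤ w (i + b)
    w-mono i b = ≤-trans (≤-trans (m≤m+n (w i) _) (pos-lower (w i) (λ j → d (i + j)) 0 (λ _ → z≤n) b))
                         (≤-reflexive (pos-+ x d i b))

    -- Otherwise `m` terms lie in one cell. Reduced modulo `L` they form a wave of `φ`,
    -- monochromatic since a single injective `punchIn` acts on the cell.
    escape-cell : ∀ i → (∀ b → b < m → χ t (w (i + b)) ≡ c) → w i ÷ L < w (i + m) ÷ L
    escape-cell i col with w i ÷ L <? w (i + m) ÷ L
    ... | yes lt  = lt
    ... | no  ¬lt = ⊥-elim (noWave (φ x′) x′ d′ (λ le → mono (+-monoʳ-≤ i le))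
                             (≤-trans 1≤d₀ (mono z≤n)) inside color)
      where
      j  = w i ÷ L
      x′ = w i % L
      d′ : ℕ → ℕ
      d′ b = d (i + b)
      shifted : ∀ b → w (i + b) ≡ pos x′ d′ b + j * L
      shifted b = begin
        w (i + b)             ≡⟨ pos-+ x d i b ⟨
        pos (w i) d′ b        ≡⟨ cong (λ z → pos z d′ b) (trans (m≡m%n+[m/n]*n (w i) L) (+-comm x′ (j * L))) ⟩
        pos (j * L + x′) d′ b ≡⟨ pos-shift (j * L) x′ d′ b ⟩
        j * L + pos x′ d′ b   ≡⟨ +-comm (j * L) _ ⟩
        pos x′ d′ b + j * L ∎
        where open ≡-Reasoning
      inside : ∀ b → b < m → pos x′ d′ b < L
      inside b b<m = +-cancelʳ-< (j * L) _ L (begin-strict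
        pos x′ d′ b + j * L  ≡⟨ shifted b ⟨
        w (i + b)            ≤⟨ w-mono (i + b) (m ∸ b) ⟩
        w (i + b + (m ∸ b))  ≡⟨ cong w (trans (+-assoc i b (m ∸ b)) (cong (λ z → i + z) (m+[n∸m]≡n (<⇒≤ b<m)))) ⟩
        w (i + m)            <⟨ proj₂ (proj₂ (floor (w (i + m)) L)) ⟩
        suc (w (i + m) ÷ L) * L ≤⟨ *-monoˡ-≤ L (s≤s (≮⇒≥ ¬lt)) ⟩
        suc j * L ∎)
        where open ≤-Reasoning
      χ-inside : ∀ b → b < m → punchIn (missing t j) (φ (pos x′ d′ b)) ≡ c
      χ-inside b b<m = trans (cong₂ (λ v z → punchIn (missing t v) (φ z)) (sym cell) (sym offset)) (col b b<m)
        where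
        cell : w (i + b) ÷ L ≡ j
        cell = quotient-unique L (≤-trans (m≤n+m (j * L) _) (≤-reflexive (sym (shifted b))))
          (≤-trans (≤-reflexive (cong suc (shifted b))) (+-monoˡ-< (j * L) (inside b b<m)))
        offset : w (i + b) % L ≡ pos x′ d′ b
        offset = trans (cong (_% L) (shifted b))
          (trans ([m+kn]%n≡m%n (pos x′ d′ b) j L) (m<n⇒m%n≡m (inside b b<m)))
      color : ∀ b → b < m → φ (pos x′ d′ b) ≡ φ x′
      color b b<m = punchIn-injective _ _ _
        (trans (χ-inside b b<m) (sym (χ-inside 0 (≤-<-trans z≤n b<m))))

    -- With gaps below `L` the wave cannot jump over the cell of the next superblock that misses
    -- `c`, yet `escape-cell` carries it `2 * P` cells forward, which is beyond that cell.
    gap-grows : (∀ i → i ≤ 2 * P * m → χ t (w i) ≡ c) → L ≤ d (2 * P * m)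
    gap-grows col with L ≤? d (2 * P * m)
    ... | yes le = le
    ... | no ¬le with missing-cell c t (suc (x ÷ L ÷ P))
    ... | j , lo , hi , miss = ⊥-elim (<-irrefl refl (begin-strict
      x ÷ L + 2 * P        ≤⟨ progress (2 * P) ≤-refl ⟩
      w (2 * P * m) ÷ L    <⟨ m<n*o⇒m/o<n (trapped (2 * P * m) ≤-refl) ⟩
      j                    <⟨ hi ⟩
      (2 + x ÷ L ÷ P) * P  ≡⟨ identity (x ÷ L ÷ P) P ⟩
      x ÷ L ÷ P * P + 2 * P ≤⟨ +-monoˡ-≤ (2 * P) (m/n*n≤m (x ÷ L) P) ⟩
      x ÷ L + 2 * P ∎))
      where
      open ≤-Reasoning
      identity : ∀ a b → (2 + a) * b ≡ a * b + 2 * b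
      identity = solve-∀
      trapped : ∀ i → i ≤ 2 * P * m → w i < j * L
      trapped zero    _  = <-≤-trans (proj₂ (proj₂ (floor x L)))
        (*-monoˡ-≤ L (≤-trans (proj₂ (proj₂ (floor (x ÷ L) P))) lo))
      trapped (suc i) i< = ≰⇒> λ jL≤ → punchInᵢ≢i _ _ (trans (col (suc i) i<)
        (sym (trans (cong (missing t) (quotient-unique {j} L jL≤ (begin-strict
          w i + d i  <⟨ +-mono-<-≤ (trapped i (<⇒≤ i<)) (≤-trans (mono (<⇒≤ i<)) (<⇒≤ (≰⇒> ¬le))) ⟩
          j * L + L  ≡⟨ +-comm (j * L) L ⟩
          suc j * L ∎))) miss)))
      progress : ∀ a → a ≤ 2 * P → x ÷ L + a ≤ w (a * m) ÷ L
      progress zero    _  = ≤-reflexive (+-identityʳ _)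
      progress (suc a) a< = begin
        x ÷ L + suc a        ≡⟨ +-suc (x ÷ L) a ⟩
        suc (x ÷ L + a)      ≤⟨ s≤s (progress a (<⇒≤ a<)) ⟩
        suc (w (a * m) ÷ L)  ≤⟨ escape-cell (a * m) (λ b b<m → col (a * m + b) (begin
          a * m + b   ≤⟨ +-monoʳ-≤ (a * m) (<⇒≤ b<m) ⟩
          a * m + m   ≡⟨ +-comm (a * m) m ⟩
          suc a * m   ≤⟨ *-monoˡ-≤ m a< ⟩
          2 * P * m   ∎)) ⟩
        w (a * m + m) ÷ L    ≡⟨ cong (λ i → w i ÷ L) (+-comm (a * m) m) ⟩
        w (suc a * m) ÷ L    ∎

  -- `2 * P * m` steps bring the gap to `L`, `J` runs of `T` steps bring it to `G * h`, and `K` more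
  -- steps leave the interval.
  level : NoWave φ L m → ∀ J G K → R * (N J G K * N J G K) * 16 ^ G < 2 ^ J →
          ∃[ χ′ ] NoWave {R} χ′ (K * (G * h)) (suc (2 * P * m + J * T + K))
  level noWave J G zero    small = χ (λ _ → 0) , λ c x d mono 1≤d₀ inside color → n≮0 (inside 0 z<s)
  level noWave J G (suc K) small with survivors-few J G (suc K) small
  ... | t , none = χ t , contradictory
    where
    N′ = N J G (suc K)
    contradictory : NoWave (χ t) N′ (suc (2 * P * m + J * T + suc K))
    contradictory c x d mono 1≤d₀ inside color
      with floor (pos x d (2 * P * m)) q | floor (d (2 * P * m)) h
    ... | X , X≤ , <X | D , D≤ , <D
      with m≤n⇒∃[o]m+o≡n 2T≤D
      where
      2T≤D : 2 * T ≤ D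
      2T≤D = ≤-pred (*-cancelʳ-< h (2 * T) (suc D) (≤-<-trans (≤-trans (≤-reflexive (*-assoc 2 T h))
        (gap-grows noWave t c x d mono 1≤d₀ λ i i≤ → color i (s≤s (≤-trans i≤
          (≤-trans (m≤m+n (2 * P * m) (J * T)) (m≤m+n _ (suc K))))))) <D))
    ... | D′ , refl = <-irrefl refl (begin-strict
      suc K * (G * h)                             ≤⟨ m≤n+m _ (pos x d n₂) ⟩
      pos x d n₂ + suc K * (G * h)                ≤⟨ pos-lower (pos x d n₂) (λ j → d (n₂ + j)) (G * h)
                                                       (λ j → ≤-trans wide (mono (m≤m+n n₂ j))) (suc K) ⟩
      pos (pos x d n₂) (λ j → d (n₂ + j)) (suc K) ≡⟨ pos-+ x d n₂ (suc K) ⟩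
      pos x d (n₂ + suc K)                        <⟨ inside (n₂ + suc K) ≤-refl ⟩
      suc K * (G * h) ∎)
      where
      open ≤-Reasoning
      n₁ = 2 * P * m
      n₂ = n₁ + J * T
      n₂< : n₂ < suc (n₂ + suc K)
      n₂< = s≤s (m≤m+n n₂ (suc K))
      n₁+1<k : suc n₁ < suc (n₂ + suc K)
      n₁+1<k = s≤s (≤-trans (s≤s (m≤m+n n₁ (J * T))) (≤-trans (m≤m+n (suc n₂) K) (≤-reflexive (sym (+-suc n₂ K)))))
      X<N : X < N′
      X<N = ≤-<-trans (≤-trans (m≤m*n X q) X≤) (inside n₁ (<-trans (n<1+n n₁) n₁+1<k))
      D′<N : D′ < N′
      D′<N = ≤-<-trans (≤-trans (m≤n+m D′ (2 * T)) (≤-trans (m≤m*n _ h) (≤-trans D≤ (m≤n+m _ (pos x d n₁)))))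
                       (inside (suc n₁) n₁+1<k)
      dead : paths (phase (toℕ c)) J X (2 * T + D′) G t ≡ 0
      dead = n≤0⇒n≡0 (≤-trans (term≤sum< N′ (λ D → paths (phase (toℕ c)) J X (2 * T + D) G t) D′<N)
        (≤-trans (term≤sum< N′ (λ X → sum< N′ λ D → paths (phase (toℕ c)) J X (2 * T + D) G t) X<N)
        (≤-trans (term≤sum< R (λ c → sum< N′ λ X → sum< N′ λ D → paths (phase c) J X (2 * T + D) G t) (toℕ<n c))
                 (≤-reflexive none))))
      wide : G * h ≤ d n₂
      wide with G * h ≤? d n₂
      ... | yes le = le
      -- A smaller gap keeps the growth within `G`, so `wave-path` yields a record, contrary to
      -- `dead`.
      ... | no ¬le = ⊥-elim (n≮0 (subst (0 <_) dead (wave-path P u h t (phase (toℕ c)) (λ w → χ t w ≡ c)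
        (hit t c) J (pos x d n₁) (λ j → d (n₁ + j)) X (2 * T + D′) G
        (λ le → mono (+-monoʳ-≤ n₁ le)) X≤ <X
        (subst (λ z → (2 * T + D′) * h ≤ d z) (sym (+-identityʳ n₁)) D≤)
        (subst (λ z → d z < suc (2 * T + D′) * h) (sym (+-identityʳ n₁)) <D)
        (<-≤-trans (≰⇒> ¬le) (*-monoˡ-≤ h (≤-trans (m≤n+m G (2 * T + D′)) (n≤1+n _))))
        λ i i<JT → trans (cong (χ t) (pos-+ x d n₁ i))
          (color (n₁ + i) (<-trans (+-monoʳ-< n₁ i<JT) n₂<)))))

-- Parameter choices for two and three colors

NoWave-weaken : ∀ {r} (χ : ℕ → Fin r) {N N′ k k′} → N′ ≤ N → k ≤ k′ → NoWave χ N k → NoWave χ N′ k′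
NoWave-weaken χ N′≤N k≤k′ noWave c x d mono 1≤d₀ inside color = noWave c x d mono 1≤d₀
  (λ i i<k → <-≤-trans (inside i (<-≤-trans i<k k≤k′)) N′≤N)
  (λ i i<k → color i (<-≤-trans i<k k≤k′))

-- The one-color case from which the levels start.
NoWave-short : ∀ {r} (χ : ℕ → Fin r) N → NoWave χ N (suc N)
NoWave-short χ N c x d mono 1≤d₀ inside color = <-irrefl refl (begin-strict
  N            ≡⟨ *-identityʳ N ⟨
  N * 1        ≤⟨ m≤n+m (N * 1) x ⟩
  x + N * 1    ≤⟨ pos-lower x d 1 (λ j → ≤-trans 1≤d₀ (mono z≤n)) N ⟩
  pos x d N    <⟨ inside N ≤-refl ⟩
  N ∎)
  where open ≤-Reasoning

n<2^n : ∀ n → n < 2 ^ n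
n<2^n zero    = z<s
n<2^n (suc n) = +-mono-≤ (≤-trans (s≤s z≤n) (n<2^n n)) (≤-trans (n<2^n n) (m≤m+n (2 ^ n) 0))

-- With `B = 2 ^ n` the left side is below `B ^ 2 * B ^ 10 * B ^ 4`, so `16 * n` runs suffice for
-- growth `n`.
few-states : ∀ R n N → R ≤ 3 → 1 ≤ n → N ≤ n ^ 5 → R * (N * N) * 16 ^ n < 2 ^ (16 * n)
few-states R n N R≤3 1≤n N≤n⁵ = begin-strict
  R * (N * N) * 16 ^ n       ≡⟨ cong (R * (N * N) *_) (^-*-assoc 2 4 n) ⟩
  R * (N * N) * 2 ^ (4 * n)  ≡⟨ cong (λ e → R * (N * N) * 2 ^ e) (*-comm 4 n) ⟩
  R * (N * N) * 2 ^ (n * 4)  ≡⟨ cong (R * (N * N) *_) (^-*-assoc 2 n 4) ⟨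
  R * (N * N) * B ^ 4        ≤⟨ *-monoˡ-≤ (B ^ 4) (*-monoʳ-≤ R (*-mono-≤ N≤ N≤)) ⟩
  R * (B ^ 5 * B ^ 5) * B ^ 4  ≡⟨ *-assoc R (B ^ 5 * B ^ 5) (B ^ 4) ⟩
  R * (B ^ 5 * B ^ 5 * B ^ 4)  <⟨ *-monoˡ-< (B ^ 5 * B ^ 5 * B ^ 4)
                                   {{m*n≢0 (B ^ 5 * B ^ 5) (B ^ 4) {{m*n≢0 (B ^ 5) (B ^ 5)}}}} R<B² ⟩
  B ^ 2 * (B ^ 5 * B ^ 5 * B ^ 4)  ≡⟨ collect ⟩
  B ^ 16                     ≡⟨ ^-*-assoc 2 n 16 ⟩
  2 ^ (n * 16)               ≡⟨ cong (2 ^_) (*-comm n 16) ⟩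
  2 ^ (16 * n) ∎
  where
  open ≤-Reasoning
  B = 2 ^ n
  instance
    B≢0 : NonZero B
    B≢0 = m^n≢0 2 n
    B^4≢0 : NonZero (B ^ 4)
    B^4≢0 = m^n≢0 B 4
    B^5≢0 : NonZero (B ^ 5)
    B^5≢0 = m^n≢0 B 5
  N≤ : N ≤ B ^ 5
  N≤ = ≤-trans N≤n⁵ (^-monoˡ-≤ 5 (<⇒≤ (n<2^n n)))
  R<B² : R < B ^ 2
  R<B² = ≤-trans (s≤s R≤3) (^-monoˡ-≤ 2 (≤-trans (s≤s 1≤n) (n<2^n n)))
  collect : B ^ 2 * (B ^ 5 * B ^ 5 * B ^ 4) ≡ B ^ 16
  collect = sym (trans (^-distribˡ-+-* B 2 14) (cong (B ^ 2 *_)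
    (trans (^-distribˡ-+-* B 10 4) (cong (_* B ^ 4) (^-distribˡ-+-* B 5 5)))))

-- The bound 1/16 on the survival probability of a run, freed of fractions.
Rare : ℕ → ℕ → Set
Rare R u = 16 * (2 * R * (2 * R) ∸ 1) ^ u ≤ (2 * R * (2 * R)) ^ u

module Construction (u n : ℕ) {{u≢0 : NonZero u}} {{n≢0 : NonZero n}} (large : 24 * u ≤ n) where

  -- `K = 24 * u * n` makes the length equal to the cell length `24 * u * n ^ 3` of the next level,
  -- where `h = n ^ 3`.
  two-colors : Rare 2 u → ∃[ χ ] NoWave {2} χ (24 * u * n * (n * n)) ((280 * u + 9) * n)
  two-colors rare =
    let (χ , noWave) = Level.level 1 u n rare (λ _ → Fin.zero) (suc L₁)
          (NoWave-short (λ _ → Fin.zero) L₁) (16 * n) n (24 * u * n)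
          (few-states 2 n (24 * u * n * (n * n)) (s≤s (s≤s z≤n)) (>-nonZero⁻¹ n) small)
    in χ , NoWave-weaken χ ≤-refl length noWave
    where
    open ≤-Reasoning
    L₁ = 2 * (2 * (2 * 2) * u * n)
    small : 24 * u * n * (n * n) ≤ n ^ 5
    small = begin
      24 * u * n * (n * n)  ≡⟨ regroup (24 * u) n ⟩
      24 * u * n ^ 3        ≤⟨ *-monoˡ-≤ (n ^ 3) large ⟩
      n * n ^ 3             ≤⟨ m≤n*m (n * n ^ 3) n ⟩
      n ^ 5 ∎
      where
      regroup : ∀ c n → c * n * (n * n) ≡ c * (n * (n * (n * 1)))
      regroup = solve-∀
    length : suc (2 * (2 * 2) * suc L₁ + 16 * n * (2 * (2 * 2) * u) + 24 * u * n) ≤ (280 * u + 9) * n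
    length = begin
      suc (2 * (2 * 2) * suc L₁ + 16 * n * (2 * (2 * 2) * u) + 24 * u * n)  ≡⟨ expand u n ⟩
      280 * u * n + 9 * 1  ≤⟨ +-monoʳ-≤ (280 * u * n) (*-monoʳ-≤ 9 (>-nonZero⁻¹ n)) ⟩
      280 * u * n + 9 * n  ≡⟨ *-distribʳ-+ n (280 * u) 9 ⟨
      (280 * u + 9) * n ∎
      where
      expand : ∀ u n → 1 + (2 * (2 * 2) * (1 + 2 * (2 * (2 * 2) * u * n)) + 16 * n * (2 * (2 * 2) * u) + 24 * u * n)
                     ≡ 280 * u * n + 9 * 1
      expand = solve-∀

  three-colors : Rare 2 u → Rare 3 u → ∃[ χ ] NoWave {3} χ (n ^ 5) ((3552 * u + 110) * n)
  three-colors rare₂ rare₃ =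
    let (χ₂ , noWave₂) = two-colors rare₂
        (χ , noWave) = Level.level 2 u (n * (n * n)) {{h≢0 = n³≢0}} rare₃ χ₂ ((280 * u + 9) * n)
          (NoWave-weaken χ₂ (≤-reflexive (cell u n)) ≤-refl noWave₂) (16 * n) n n
          (few-states 3 n (n * (n * (n * (n * n)))) ≤-refl (>-nonZero⁻¹ n) (≤-reflexive (sym volume)))
    in χ , NoWave-weaken χ (≤-reflexive volume) length noWave
    where
    open ≤-Reasoning
    n³≢0 : NonZero (n * (n * n))
    n³≢0 = m*n≢0 n (n * n) {{n≢0}} {{m*n≢0 n n}}
    volume : n ^ 5 ≡ n * (n * (n * (n * n)))
    volume = cong (λ z → n * (n * (n * (n * z)))) (*-identityʳ n)
    cell : ∀ u n → 2 * (2 * (2 * 3) * u * (n * (n * n))) ≡ 24 * u * n * (n * n)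
    cell = solve-∀
    length : suc (2 * (2 * 3) * ((280 * u + 9) * n) + 16 * n * (2 * (2 * 3) * u) + n) ≤ (3552 * u + 110) * n
    length = begin
      suc (2 * (2 * 3) * ((280 * u + 9) * n) + 16 * n * (2 * (2 * 3) * u) + n)  ≤⟨ +-monoˡ-≤ _ (>-nonZero⁻¹ n) ⟩
      n + (2 * (2 * 3) * ((280 * u + 9) * n) + 16 * n * (2 * (2 * 3) * u) + n)  ≡⟨ expand u n ⟩
      (3552 * u + 110) * n ∎
      where
      expand : ∀ u n → n + (2 * (2 * 3) * ((280 * u + 9) * n) + 16 * n * (2 * (2 * 3) * u) + n)
                     ≡ (3552 * u + 110) * n
      expand = solve-∀

-- From gap sequences to the lower bound for `AW k 3`

module WaveGaps {k M : ℕ} (w : Fin (2 + k) → Fin M) (wave : IsAscendingWave (value ∘ w)) where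

  open IsAscendingWave wave

  cap : ℕ → Fin (2 + k)
  cap i = fromℕ< {i ⊓ suc k} (s≤s (m⊓n≤n i (suc k)))

  toℕ-cap : ∀ {i} → i ≤ suc k → toℕ (cap i) ≡ i
  toℕ-cap i≤ = trans (toℕ-fromℕ< _) (m≤n⇒m⊓n≡m i≤)

  -- Indices are cut off at the end of the wave, so its last gap repeats and `gaps` is total and
  -- monotone.
  at gap gaps : ℕ → ℕ
  at i   = toℕ (w (cap i))
  gap i  = at (suc i) ∸ at i
  gaps i = gap (i ⊓ k)

  at-increasing : ∀ {i} → i ≤ k → at i < at (suc i)
  at-increasing {i} i≤k = ≤-pred (increasing (cap i) (cap (suc i))
    (subst₂ _<_ (sym (toℕ-cap (m≤n⇒m≤1+n i≤k))) (sym (toℕ-cap (s≤s i≤k))) (n<1+n i)))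

  gap-monotone : ∀ {i j} → i ≤ j → j ≤ k → gap i ≤ gap j
  gap-monotone {i} {j} i≤j j≤k with m≤n⇒m<n∨m≡n i≤j
  ... | inj₂ refl = ≤-refl
  gap-monotone {i} {suc j} i≤j j<k | inj₁ (s≤s i≤j′) =
    ≤-trans (gap-monotone i≤j′ (<⇒≤ j<k))
      (convex (cap j) (cap (suc j)) (cap (2 + j))
        (trans (toℕ-cap (m≤n⇒m≤1+n j<k)) (cong suc (sym (toℕ-cap (<⇒≤ (m≤n⇒m≤1+n j<k))))))
        (trans (toℕ-cap (s≤s j<k)) (cong suc (sym (toℕ-cap (m≤n⇒m≤1+n j<k))))))

  gaps-monotone : Monotone gaps
  gaps-monotone {i} {j} i≤j = gap-monotone (⊓-monoˡ-≤ k i≤j) (m⊓n≤n j k)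

  pos-at : ∀ i → i ≤ suc k → pos (at 0) gaps i ≡ at i
  pos-at zero    _         = refl
  pos-at (suc i) (s≤s i≤k) = trans
    (cong₂ _+_ (pos-at i (m≤n⇒m≤1+n i≤k)) (cong gap (m≤n⇒m⊓n≡m i≤k)))
    (m+[n∸m]≡n (<⇒≤ (at-increasing i≤k)))

NoWave⇒long : ∀ {r N k M} (χ : ℕ → Fin r) → NoWave χ N (2 + k) → Forces (2 + k) r M → N < M
NoWave⇒long {r} {N} {k} {M} χ noWave forces with N <? M
... | yes N<M = N<M
... | no  N≮M with forces (χ ∘ toℕ)
... | w , wave , mono = let open WaveGaps w wave in ⊥-elim (noWave (χ (at 0)) (at 0) gaps gaps-monotone
  (m<n⇒0<n∸m (at-increasing z≤n))
  (λ { i (s≤s i≤) → subst (_< N) (sym (pos-at i i≤)) (<-≤-trans (toℕ<n (w (cap i))) (≮⇒≥ N≮M)) })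
  (λ { i (s≤s i≤) → trans (cong χ (pos-at i i≤)) (mono _ _) }))

-- For `n` the rounded quotient of `k` by `C`, rounding loses at most a factor 2 since `n` is
-- positive; hence `(2 * C) ^ 5`.
AW-lower : ∀ C n₀ D {{_ : NonZero C}} {{_ : NonZero n₀}} → (2 * C) ^ 5 ≤ D →
  (∀ n → n₀ ≤ n → ∃[ χ ] NoWave {3} χ (n ^ 5) (C * n)) →
  ∀ k → n₀ * C ≤ k → 2 ≤ k → k ^ 5 ≤ AW k 3 * D
AW-lower C n₀ D ≤D colorings k@(suc (suc _)) large _ =
  let (χ , noWave) = colorings n n₀≤n
      n⁵<AW = NoWave⇒long χ
        (NoWave-weaken χ ≤-refl (≤-trans (≤-reflexive (*-comm C n)) (m/n*n≤m k C)) noWave)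
        (IsAW.forces (AW-isAW k 3))
  in begin
  k ^ 5                 ≤⟨ ^-monoˡ-≤ 5 k≤ ⟩
  (2 * C * n) ^ 5       ≡⟨ power (2 * C) n ⟩
  n ^ 5 * (2 * C) ^ 5   ≤⟨ *-mono-≤ (<⇒≤ n⁵<AW) ≤D ⟩
  AW k 3 * D            ∎
  where
  open ≤-Reasoning
  n = k ÷ C
  n₀≤n : n₀ ≤ n
  n₀≤n = ≤-trans (≤-reflexive (sym (m*n/n≡m n₀ C))) (/-monoˡ-≤ C large)
  k≤ : k ≤ 2 * C * n
  k≤ = begin
    k             ≤⟨ <⇒≤ (proj₂ (proj₂ (floor k C))) ⟩
    (1 + n) * C   ≤⟨ *-monoˡ-≤ C (+-monoˡ-≤ n (≤-trans (>-nonZero⁻¹ n₀) n₀≤n)) ⟩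
    (n + n) * C   ≡⟨ double n C ⟩
    2 * C * n ∎
    where
    double : ∀ n c → (n + n) * c ≡ 2 * c * n
    double = solve-∀
  power : ∀ c n → c * n * (c * n * (c * n * (c * n * (c * n * 1))))
                ≡ n * (n * (n * (n * (n * 1)))) * (c * (c * (c * (c * (c * 1)))))
  power = solve-∀
AW-lower C n₀ D ≤D colorings (suc zero) large (s≤s ())

-- `u = 100` is almost minimal for three colors, as `(35 / 36) ^ 100` is about 0.06, just below
-- 1/16. Then `24 * u = 2400` and `3552 * u + 110 = 355310`.
lower-colorings : ∀ n → 2400 ≤ n → ∃[ χ ] NoWave {3} χ (n ^ 5) (355310 * n)
lower-colorings n 2400≤n = Construction.three-colors 100 n {{_}} {{>-nonZero (≤-trans (s≤s z≤n) 2400≤n)}}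
  2400≤n (≤ᵇ⇒≤ _ _ _) (≤ᵇ⇒≤ _ _ _)

-- Upper bound

-- Indexed by number of terms, last term and last gap; a single term counts as having gap 1.
data Snoc (P : ℕ → Set) : (n x d : ℕ) → Set where
  single : ∀ {x} → P x → Snoc P 1 x 1
  snoc   : ∀ {n x d e} → Snoc P n x d → d ≤ e → P (x + e) → Snoc P (suc n) (x + e) e

mapSnoc : ∀ {P Q : ℕ → Set} → (∀ {y} → P y → Q y) → ∀ {n x d} → Snoc P n x d → Snoc Q n x d
mapSnoc f (single p)      = single (f p)
mapSnoc f (snoc s d≤e p) = snoc (mapSnoc f s) d≤e (f p)

last-term : ∀ {P n x d} → Snoc P n x d → P x
last-term (single p)   = p
last-term (snoc _ _ p) = p

1≤gap : ∀ {P n x d} → Snoc P n x d → 1 ≤ d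
1≤gap (single _)      = ≤-refl
1≤gap (snoc s d≤e _) = ≤-trans (1≤gap s) d≤e

-- Starting one below the term gives it gap 1, the convention of `Snoc`.
single-chain : ∀ {P m x} → 0 < x → P x → Chain P m x 1 → ∃[ x₀ ] ∃[ d₀ ] Chain P (suc m) x₀ d₀
single-chain {x = suc x} _ p t =
  x , 0 , cons (suc x) (n<1+n x) z≤n p (subst (Chain _ _ (suc x)) (sym (m+n∸n≡m 1 x)) t)

-- `Snoc` grows at the end, as the greedy extension does, and `Chain` at the front; the terms move
-- over one at a time.
snoc-chain : ∀ {P n m x d} → (∀ {y} → P y → 0 < y) → Snoc P n x d → Chain P m x d →
             ∃[ x₀ ] ∃[ d₀ ] Chain P (n + m) x₀ d₀
snoc-chain 0< (single p) t = single-chain (0< p) p t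
snoc-chain {P} {suc n} {m} 0< (snoc {x = x} {d} {e} s d≤e p) t
  with snoc-chain 0< s (cons (x + e) (m<m+n x (≤-trans (1≤gap s) d≤e))
         (≤-trans d≤e (≤-reflexive last-gap)) p (subst (Chain P m (x + e)) last-gap t))
  where
  last-gap : e ≡ x + e ∸ x
  last-gap = sym (m+n∸m≡n x e)
... | x₀ , d₀ , t′ = x₀ , d₀ , subst (λ l → Chain P l x₀ d₀) (+-suc n m) t′

record Lengths : Set where
  field
    len inc : ℕ → ℕ
open Lengths

-- bounds r describes windows for r + 1 colors: a window of length len k contains a
-- monochromatic wave of k terms whose last gap is at most inc k.
bounds : ℕ → Lengths
bounds zero    = record { len = λ k → k ; inc = λ _ → 1 }
bounds (suc r) = record { len = len′ ; inc = inc′ }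
  where
  inc′ len′ : ℕ → ℕ
  inc′ zero    = 0
  inc′ (suc k) = inc′ k + len (bounds r) (suc k)
  len′ zero    = 0
  len′ (suc k) = len′ k + inc′ (suc k)

-- The new `inc` contains `len` for fewer colors as a summand, so a wave found with fewer colors
-- keeps the gap bound.
inc≤len : ∀ r k → inc (bounds r) (suc k) ≤ len (bounds r) (suc k)
inc≤len zero    k = s≤s z≤n
inc≤len (suc r) k = m≤n+m _ (len (bounds (suc r)) k)

len-1 : ∀ r → len (bounds r) 1 ≡ 1
len-1 zero    = refl
len-1 (suc r) = len-1 r

-- The color to drop is not known in advance; with a list `σ` it is dropped by `σ ∘ punchIn j`.
UsesColors : ∀ {r} → (Fin r → ℕ) → (ℕ → ℕ) → (lo hi : ℕ) → Set
UsesColors σ c lo hi = ∀ y → lo < y → y ≤ hi → ∃[ j ] c y ≡ σ j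

WaveIn : ∀ {r} → (Fin r → ℕ) → (ℕ → ℕ) → (lo hi k δ : ℕ) → Set
WaveIn σ c lo hi k δ = ∃[ j ] ∃[ x ] ∃[ d ] Snoc (ColoredIn c lo hi (σ j)) k x d × d ≤ δ

wave-in-window : ∀ r k (σ : Fin (suc r) → ℕ) c a →
  UsesColors σ c a (a + len (bounds r) (suc k)) →
  WaveIn σ c a (a + len (bounds r) (suc k)) (suc k) (inc (bounds r) (suc k))
wave-in-window r zero σ c a uses =
  let y≤ = +-monoʳ-≤ a (≤-reflexive (sym (len-1 r)))
      (j , eq) = uses (a + 1) (m<m+n a z<s) y≤
  in j , a + 1 , 1 , single (m<m+n a z<s , y≤ , eq) , 1≤inc r
  where
  1≤inc : ∀ r → 1 ≤ inc (bounds r) 1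
  1≤inc zero    = ≤-refl
  1≤inc (suc r) = ≤-reflexive (sym (len-1 r))
wave-in-window zero (suc k) σ c a uses
  with wave-in-window zero k σ c a (λ y lo hi → uses y lo (≤-trans hi (+-monoʳ-≤ a (n≤1+n (suc k)))))
... | Fin.zero , x , d , s , d≤1 =
  Fin.zero , x + 1 , 1 ,
  snoc (mapSnoc (λ (lo , hi , eq) → lo , ≤-trans hi (+-monoʳ-≤ a (n≤1+n (suc k))) , eq) s) d≤1
    (lo′ , hi′ , color) , ≤-refl
  where
  lo′ : a < x + 1
  lo′ = ≤-trans (proj₁ (last-term s)) (m≤m+n x 1)
  hi′ : x + 1 ≤ a + suc (suc k)
  hi′ = ≤-trans (+-monoˡ-≤ 1 (proj₁ (proj₂ (last-term s))))
          (≤-reflexive (trans (+-assoc a (suc k) 1) (cong (λ z → a + z) (+-comm (suc k) 1))))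
  color : c (x + 1) ≡ σ Fin.zero
  color with uses (x + 1) lo′ hi′
  ... | Fin.zero , eq = eq
wave-in-window (suc r) (suc k) σ c a uses
  with wave-in-window (suc r) k σ c a (λ y lo hi → uses y lo (≤-trans hi (+-monoʳ-≤ a (m≤m+n _ _))))
... | j , x , d , s , d≤
  with anyUpTo? (λ i → c (x + (d + suc i)) ≟ σ j) (len (bounds r) (suc (suc k)))
... | yes (i , i< , eq) = j , x + (d + suc i) , d + suc i ,
  snoc (mapSnoc (λ (lo , hi , eq) → lo , ≤-trans hi (+-monoʳ-≤ a (m≤m+n _ _)) , eq) s) (m≤m+n d (suc i))
    (≤-trans (proj₁ (last-term s)) (m≤m+n x _) ,
     ≤-trans (+-mono-≤ (proj₁ (proj₂ (last-term s))) (+-mono-≤ d≤ i<)) (≤-reflexive (+-assoc a _ _)) , eq) ,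
  +-mono-≤ d≤ i<
-- The window after `x + d` avoids color `σ j`, so a full wave with one color fewer exists there.
... | no none with wave-in-window r (suc k) (σ ∘ punchIn j) c (x + d) other
  where
  window : x + d + len (bounds r) (suc (suc k)) ≤ a + len (bounds (suc r)) (suc (suc k))
  window = begin
    x + d + len (bounds r) (suc (suc k))    ≡⟨ +-assoc x d _ ⟩
    x + (d + len (bounds r) (suc (suc k)))  ≤⟨ +-mono-≤ (proj₁ (proj₂ (last-term s))) (+-monoˡ-≤ _ d≤) ⟩
    _                                       ≡⟨ +-assoc a _ _ ⟩
    a + len (bounds (suc r)) (suc (suc k))  ∎
    where open ≤-Reasoning
  other : UsesColors (σ ∘ punchIn j) c (x + d) (x + d + len (bounds r) (suc (suc k)))
  other y lo hi with uses y (≤-trans (proj₁ (last-term s)) (≤-trans (m≤m+n x d) (<⇒≤ lo))) (≤-trans hi window)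
  ... | j′ , eq with j Finₚ.≟ j′
  ... | no j≢j′ = punchOut j≢j′ , trans eq (cong σ (sym (punchIn-punchOut j≢j′)))
  ... | yes refl with m≤n⇒∃[o]m+o≡n lo
  ... | i , refl = ⊥-elim (none (i ,
    +-cancelˡ-≤ (x + d) _ _ (≤-trans (≤-reflexive (+-suc (x + d) i)) hi) ,
    trans (cong c (trans (sym (+-assoc x d (suc i))) (+-suc (x + d) i))) eq))
... | j′ , x′ , d′ , s′ , d′≤ = punchIn j j′ , x′ , d′ ,
  mapSnoc (λ (lo , hi , eq) →
    ≤-trans (proj₁ (last-term s)) (≤-trans (m≤m+n x d) (<⇒≤ lo)) ,
    ≤-trans hi (≤-trans (≤-reflexive (+-assoc x d _))
      (≤-trans (+-mono-≤ (proj₁ (proj₂ (last-term s))) (+-monoˡ-≤ _ d≤)) (≤-reflexive (+-assoc a _ _)))) , eq) s′ ,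
  ≤-trans d′≤ (≤-trans (inc≤len r (suc k)) (m≤n+m _ _))

len-forces : ∀ r k → Forces (suc k) (suc r) (len (bounds r) (suc k))
len-forces r k χ with wave-in-window r k toℕ (extended χ) 0
  (λ y lo hi → let lt = extended-below χ y lo hi in fromℕ< lt , sym (Finₚ.toℕ-fromℕ< lt))
... | j , x , d , s , _ with snoc-chain proj₁ s nil
... | x₀ , d₀ , t = fromFound χ (toℕ j , x₀ , d₀ , subst (λ l → Chain (ColoredIn (extended χ) 0 (len (bounds r) (suc k)) (toℕ j)) l x₀ d₀) (+-identityʳ (suc k)) t)

-- Closed forms of the gap bounds and window lengths

inc₂ : ∀ k → 2 * inc (bounds 1) k ≡ k * (1 + k)
inc₂ zero    = refl
inc₂ (suc k) = trans (*-distribˡ-+ 2 (inc (bounds 1) k) (suc k))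
  (trans (cong (_+ 2 * suc k) (inc₂ k)) (eq k))
  where
  eq : ∀ k → k * (1 + k) + 2 * (1 + k) ≡ (1 + k) * (2 + k)
  eq = solve-∀

len₂ : ∀ k → 6 * len (bounds 1) k ≡ k * (1 + k) * (2 + k)
len₂ zero    = refl
len₂ (suc k) = trans (split (len (bounds 1) k) (inc (bounds 1) (suc k)))
  (trans (cong₂ (λ a b → a + 3 * b) (len₂ k) (inc₂ (suc k))) (eq k))
  where
  split : ∀ a b → 6 * (a + b) ≡ 6 * a + 3 * (2 * b)
  split = solve-∀
  eq : ∀ k → k * (1 + k) * (2 + k) + 3 * ((1 + k) * (2 + k)) ≡ (1 + k) * (2 + k) * (3 + k)
  eq = solve-∀

inc₃ : ∀ k → 24 * inc (bounds 2) k ≡ k * (1 + k) * (2 + k) * (3 + k)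
inc₃ zero    = refl
inc₃ (suc k) = trans (split (inc (bounds 2) k) (len (bounds 1) (suc k)))
  (trans (cong₂ (λ a b → a + 4 * b) (inc₃ k) (len₂ (suc k))) (eq k))
  where
  split : ∀ a b → 24 * (a + b) ≡ 24 * a + 4 * (6 * b)
  split = solve-∀
  eq : ∀ k → k * (1 + k) * (2 + k) * (3 + k) + 4 * ((1 + k) * (2 + k) * (3 + k))
           ≡ (1 + k) * (2 + k) * (3 + k) * (4 + k)
  eq = solve-∀

-- The last of four iterated sums of `k`, all of them binomial coefficients; this one is `k + 4`
-- over 5.
len₃ : ∀ k → 120 * len (bounds 2) k ≡ k * (1 + k) * (2 + k) * (3 + k) * (4 + k)
len₃ zero    = refl
len₃ (suc k) = trans (split (len (bounds 2) k) (inc (bounds 2) (suc k)))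
  (trans (cong₂ (λ a b → a + 5 * b) (len₃ k) (inc₃ (suc k))) (eq k))
  where
  split : ∀ a b → 120 * (a + b) ≡ 120 * a + 5 * (24 * b)
  split = solve-∀
  eq : ∀ k → k * (1 + k) * (2 + k) * (3 + k) * (4 + k) + 5 * ((1 + k) * (2 + k) * (3 + k) * (4 + k))
           ≡ (1 + k) * (2 + k) * (3 + k) * (4 + k) * (5 + k)
  eq = solve-∀

-- 238 makes the comparison for `len` an equality at `k = 1`; the difference, `excess`, is a
-- polynomial in `k - 1` with nonnegative coefficients.
AW-upper : ∀ k → 1 ≤ k → AW k 3 * (120 * suc k) ≤ k ^ 5 * (suc k + 238)
AW-upper (suc k) _ = begin
  AW (suc k) 3 * (120 * (2 + k))          ≤⟨ *-monoˡ-≤ (120 * (2 + k)) (IsAW.least (AW-isAW (suc k) 3) l 1≤l (len-forces 2 k)) ⟩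
  l * (120 * (2 + k))                     ≡⟨ swap l (2 + k) ⟩
  120 * l * (2 + k)                       ≡⟨ cong (_* (2 + k)) (len₃ (suc k)) ⟩
  (1 + k) * (2 + k) * (3 + k) * (4 + k) * (5 + k) * (2 + k)  ≤⟨ m≤m+n _ _ ⟩
  (1 + k) * (2 + k) * (3 + k) * (4 + k) * (5 + k) * (2 + k) + excess k  ≡⟨ identity k ⟩
  suc k ^ 5 * (2 + k + 238) ∎
  where
  open ≤-Reasoning
  l = len (bounds 2) (suc k)
  excess : ℕ → ℕ
  excess k = k * (533 + k * (1681 + k * (2015 + k * (1095 + k * 228))))
  1≤l : 1 ≤ l
  1≤l = ≤-trans (1≤inc₃ k) (inc≤len 2 k)
    where
    1≤inc₃ : ∀ k → 1 ≤ inc (bounds 2) (suc k)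
    1≤inc₃ zero    = ≤-refl
    1≤inc₃ (suc k) = ≤-trans (1≤inc₃ k) (m≤m+n _ _)
  swap : ∀ l a → l * (120 * a) ≡ 120 * l * a
  swap = solve-∀
  identity : ∀ k → (1 + k) * (2 + k) * (3 + k) * (4 + k) * (5 + k) * (2 + k) + (k * (533 + k * (1681 + k * (2015 + k * (1095 + k * 228)))))
    ≡ (1 + k) * ((1 + k) * ((1 + k) * ((1 + k) * ((1 + k) * 1)))) * (2 + k + 238)
  identity = solve-∀

-- Passage to rational inequalities

fraction≤fromℕ : ∀ a b d .{{_ : NonZero d}} → a ≤ b * d → (+ a / d) ℚᵘ.≤ fromℕ b
fraction≤fromℕ a b (suc d) le = ℚᵘ.*≤* (subst₂ ℤ._≤_
  (sym (ℤ.*-identityʳ (+ a))) (ℤ.pos-* b (suc d)) (ℤ.+≤+ le))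

error : ℕ → ℚᵘ
error k = + 238 / suc k

error-vanishes : IsLittleO[1] error
-- Here `q` is the denominator of `ε` minus 1.
error-vanishes (ℚᵘ.mkℚᵘ (+ suc p) q) _ = 238 * suc q , λ k le →
  ℚᵘ.*≤* (ℤ.+≤+ (≤-trans le (≤-trans (n≤1+n k) (m≤n*m (suc k) (suc p)))))
error-vanishes (ℚᵘ.mkℚᵘ (+ zero) q) (ℚᵘ.*<* (ℤ.+<+ ()))
error-vanishes (ℚᵘ.mkℚᵘ (ℤ.-[1+ _ ]) q) (ℚᵘ.*<* ())

fromℕ≤product : ∀ a b k → b * (120 * suc k) ≤ a * (suc k + 238) →
                fromℕ b ℚᵘ.≤ (+ a / 120) ℚᵘ.* (1ℚᵘ ℚᵘ.+ error k)
fromℕ≤product a b k le = ℚᵘ.*≤* (subst₂ ℤ._≤_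
  (trans (ℤ.pos-* b _) (cong (λ z → + b ℤ.* + (120 * z)) (sym (*-identityˡ (suc k)))))
  (trans (ℤ.pos-* a _) (trans (cong (λ z → + a ℤ.* + (z + 238)) (sym (*-identityˡ (suc k))))
     (sym (ℤ.*-identityʳ _))))
  (ℤ.+≤+ le))

theorem3 : Eventually (λ k → (+ (k ^ 5) / (2 ^ 13 * 10 ^ 39)) ℚᵘ.≤ fromℕ (AW k 3))
    ×
    (∃[ o ] IsLittleO[1] o ×
    Eventually (λ k → fromℕ (AW k 3) ℚᵘ.≤ (+ (k ^ 5) / 120) ℚᵘ.* (1ℚᵘ ℚᵘ.+ o k)))
theorem3 =
  (2400 * 355310 , λ k large → fraction≤fromℕ (k ^ 5) (AW k 3) (2 ^ 13 * 10 ^ 39)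
    -- `(2 * 355310) ^ 5` is below `2 * 10 ^ 29`, far under the stated constant.
    (AW-lower 355310 2400 (2 ^ 13 * 10 ^ 39) (≤ᵇ⇒≤ ((2 * 355310) ^ 5) (2 ^ 13 * 10 ^ 39) _)
      lower-colorings k large (≤-trans (s≤s (s≤s z≤n)) large))) ,
  error , error-vanishes ,
  (1 , λ k 1≤k → fromℕ≤product (k ^ 5) (AW k 3) k (AW-upper k 1≤k))
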